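{- Let $k=3$ and $r_1\ge r_2\ge r_3\ge 1$. If $(r_1-1)\ge (r_2-1)+(r_3-1)$, then the arithmetic mean component competitive ratio for the 3-objective time series search problem is $$z_f^3=\frac16\left[\sqrt{4r_1+\{(r_2-1)+(r_3-1)\}^2}+(r_2+1)+(r_3+1)\right].$$
   Context: For an integer $k\ge 2$ and reals $0<m_i\le M_i$ ($1\le i\le k$), let $r_i=M_i/m_i$ be the fluctuation ratio of the price interval $[m_i,M_i]$ of the $i$th objective. It is assumed throughout that $r_1\ge\cdots\ge r_k\ge 1$. The arithmetic mean component competitive ratio of the $k$-objective time series search problem is the quantity $$z_f^k=\sup_{(x_1,\ldots,x_k)\in\mathcal{S}_f^k}\frac1k\left(\frac{M_1}{x_1}+\cdots+\frac{M_k}{x_k}\right),$$ where $$\mathcal{S}_f^k=\left\{(x_1,\ldots,x_k)\in[m_1,M_1]\times\cdots\times[m_k,M_k] : \frac1k\sum_{i=1}^k\frac{x_i}{m_i}=\frac1k\sum_{i=1}^k\frac{M_i}{x_i}\right\}.$$ -}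

module Defs where

open import Data.Bool.Base using (if_then_else_)
open import Data.Empty using (⊥-elim)
open import Data.Fin.Base as Fin using ()
open import Data.Integer.Base as ℤ using (+_)
import Data.Integer.Properties as ℤₚ
open import Data.Nat.Base as ℕ using (ℕ; zero; suc; s≤s)
import Data.Nat.Properties as ℕₚ
open import Data.Product using (Σ; ∃; _×_; _,_; proj₁; proj₂)
open import Data.Rational.Base as ℚ using (ℚ; 0ℚ; 1ℚ; ½)
import Data.Rational.Properties as ℚₚ
open import Data.Rational.Solver using (module +-*-Solver)
import Data.Rational.Unnormalised.Base as ℚᵘ
import Data.Rational.Unnormalised.Properties as ℚᵘₚ
open import Algebra.Definitions.RawMonoid ℚ.+-0-rawMonoid using () renaming (_×_ to _·_)
open import Data.Sum using (inj₁; inj₂)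
open import Data.Vec.Functional using (Vector; foldr)
open import Level using (0ℓ)
open import Relation.Binary.PropositionalEquality
  using (_≡_; refl; sym; trans; cong; cong₂; subst; subst₂)
open import Relation.Nullary using (¬_; Dec; does; yes; no)
open import Relation.Unary using (Pred)

------------------------------------------------------------------------
-- Auxiliary facts about ℚ

p-q<r⇒p<q+r : ∀ {p q r} → p ℚ.- q ℚ.< r → p ℚ.< q ℚ.+ r
p-q<r⇒p<q+r {p} {q} {r} h =
  subst (ℚ._< q ℚ.+ r)
    (solve 2 (λ q p → q :+ (p :- q) := p) refl q p) (ℚₚ.+-monoʳ-< q h)
  where open +-*-Solver

p<q+r⇒p-q<r : ∀ {p q r} → p ℚ.< q ℚ.+ r → p ℚ.- q ℚ.< r
p<q+r⇒p-q<r {p} {q} {r} h =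
  subst (p ℚ.- q ℚ.<_)
    (solve 2 (λ q r → q :+ r :- q := r) refl q r) (ℚₚ.+-monoˡ-< (ℚ.- q) h)
  where open +-*-Solver

p≤∣p∣ : ∀ p → p ℚ.≤ ℚ.∣ p ∣
p≤∣p∣ p with ℚₚ.≤-total 0ℚ p
... | inj₁ 0≤p = ℚₚ.≤-reflexive (sym (ℚₚ.0≤p⇒∣p∣≡p 0≤p))
... | inj₂ p≤0 = ℚₚ.≤-trans p≤0 (ℚₚ.0≤∣p∣ p)

∣p-q∣≡∣q-p∣ : ∀ p q → ℚ.∣ p ℚ.- q ∣ ≡ ℚ.∣ q ℚ.- p ∣
∣p-q∣≡∣q-p∣ p q = trans (sym (ℚₚ.∣-p∣≡∣p∣ (p ℚ.- q)))
  (cong ℚ.∣_∣ (solve 2 (λ p q → :- (p :- q) := q :- p) refl p q))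
  where open +-*-Solver

∣p-q∣<r⇒p<q+r : ∀ {p q r} → ℚ.∣ p ℚ.- q ∣ ℚ.< r → p ℚ.< q ℚ.+ r
∣p-q∣<r⇒p<q+r {p} {q} h = p-q<r⇒p<q+r (ℚₚ.≤-<-trans (p≤∣p∣ (p ℚ.- q)) h)

∣p-q∣<r : ∀ {p q r} → p ℚ.< q ℚ.+ r → q ℚ.< p ℚ.+ r → ℚ.∣ p ℚ.- q ∣ ℚ.< r
∣p-q∣<r {p} {q} {r} h h′ with ℚₚ.∣p∣≡p∨∣p∣≡-p (p ℚ.- q)
... | inj₁ e = subst (ℚ._< r) (sym e) (p<q+r⇒p-q<r h)
... | inj₂ e = subst (ℚ._< r)
  (sym (trans e (solve 2 (λ p q → :- (p :- q) := q :- p) refl p q)))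
  (p<q+r⇒p-q<r h′)
  where open +-*-Solver

0<p*q : ∀ {p q} → 0ℚ ℚ.< p → 0ℚ ℚ.< q → 0ℚ ℚ.< p ℚ.* q
0<p*q {p} {q} 0<p 0<q = ℚₚ.positive⁻¹ (p ℚ.* q)
  {{ℚₚ.pos*pos⇒pos p {{ℚ.positive 0<p}} q {{ℚ.positive 0<q}}}}

0<½p : ∀ {p} → 0ℚ ℚ.< p → 0ℚ ℚ.< ½ ℚ.* p
0<½p = 0<p*q (ℚₚ.positive⁻¹ ½)

½p+½p : ∀ p → ½ ℚ.* p ℚ.+ ½ ℚ.* p ≡ p
½p+½p = solve 1 (λ p → con ½ :* p :+ con ½ :* p := p) refl
  where open +-*-Solver

*-mono-≤ : ∀ {p p′ q q′} → 0ℚ ℚ.≤ q → 0ℚ ℚ.≤ p′ →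
           p ℚ.≤ p′ → q ℚ.≤ q′ → p ℚ.* q ℚ.≤ p′ ℚ.* q′
*-mono-≤ {p} {p′} {q} {q′} 0≤q 0≤p′ p≤p′ q≤q′ = ℚₚ.≤-trans
  (ℚₚ.*-monoʳ-≤-nonNeg q {{ℚ.nonNegative 0≤q}} p≤p′)
  (ℚₚ.*-monoˡ-≤-nonNeg p′ {{ℚ.nonNegative 0≤p′}} q≤q′)

p²-cancel-< : ∀ {p q} → 0ℚ ℚ.≤ p → 0ℚ ℚ.≤ q → p ℚ.* p ℚ.< q ℚ.* q → p ℚ.< q
p²-cancel-< {p} {q} 0≤p 0≤q h with p ℚₚ.<? q
... | yes p<q = p<q
... | no p≮q = ⊥-elim (ℚₚ.<-irrefl refl
  (ℚₚ.<-≤-trans h (*-mono-≤ 0≤q 0≤p (ℚₚ.≮⇒≥ p≮q) (ℚₚ.≮⇒≥ p≮q))))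

-- Total reciprocal with inv 0 = 0, so that reciprocals of sequences can
-- be taken termwise.
inv : ℚ → ℚ
inv q with q ℚₚ.≟ 0ℚ
... | yes _   = 0ℚ
... | no  q≢0 = ℚ.1/_ q {{ℚ.≢-nonZero q≢0}}

*-inv : ∀ {q} → 0ℚ ℚ.< q → q ℚ.* inv q ≡ 1ℚ
*-inv {q} 0<q with q ℚₚ.≟ 0ℚ
... | yes q≡0 = ⊥-elim (ℚₚ.<⇒≢ 0<q (sym q≡0))
... | no  q≢0 = ℚₚ.*-inverseʳ q {{ℚ.≢-nonZero q≢0}}

0<inv : ∀ {q} → 0ℚ ℚ.< q → 0ℚ ℚ.< inv q
0<inv {q} 0<q with q ℚₚ.≟ 0ℚ
... | yes q≡0 = ⊥-elim (ℚₚ.<⇒≢ 0<q (sym q≡0))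
... | no  q≢0 = ℚₚ.positive⁻¹ _ {{ℚₚ.1/pos⇒pos q {{ℚ.positive 0<q}}}}

inv-anti-≤ : ∀ {p q} → 0ℚ ℚ.< p → p ℚ.≤ q → inv q ℚ.≤ inv p
inv-anti-≤ {p} {q} 0<p p≤q = subst₂ ℚ._≤_ lhs rhs
  (*-mono-≤ (ℚₚ.<⇒≤ (0<p*q 0<ip 0<iq)) (ℚₚ.<⇒≤ 0<q) p≤q ℚₚ.≤-refl)
  where
  open +-*-Solver
  0<q  = ℚₚ.<-≤-trans 0<p p≤q
  0<ip = 0<inv 0<p
  0<iq = 0<inv 0<q
  lhs : p ℚ.* (inv p ℚ.* inv q) ≡ inv q
  lhs = trans (sym (ℚₚ.*-assoc p (inv p) (inv q)))
    (trans (cong (ℚ._* inv q) (*-inv 0<p)) (ℚₚ.*-identityˡ (inv q)))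
  rhs : q ℚ.* (inv p ℚ.* inv q) ≡ inv p
  rhs = trans (solve 3 (λ q a b → q :* (a :* b) := (q :* b) :* a) refl q (inv p) (inv q))
    (trans (cong (ℚ._* inv p) (*-inv 0<q)) (ℚₚ.*-identityˡ (inv p)))

------------------------------------------------------------------------
-- Real numbers as Cauchy sequences of rationals

Eventually : Pred ℕ 0ℓ → Set
Eventually P = ∃ λ N → ∀ n → N ℕ.≤ n → P n

_∩ᵉ_ : ∀ {P Q : Pred ℕ 0ℓ} → Eventually P → Eventually Q → Eventually (λ n → P n × Q n)
(N , f) ∩ᵉ (N′ , g) = N ℕ.⊔ N′ , λ n N⊔N′≤n →
  f n (ℕₚ.≤-trans (ℕₚ.m≤m⊔n N N′) N⊔N′≤n) ,
  g n (ℕₚ.≤-trans (ℕₚ.m≤n⊔m N N′) N⊔N′≤n)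

Cauchy : (ℕ → ℚ) → Set
Cauchy u = ∀ ε → 0ℚ ℚ.< ε →
  ∃ λ N → ∀ m n → N ℕ.≤ m → N ℕ.≤ n → ℚ.∣ u m ℚ.- u n ∣ ℚ.< ε

record ℝ : Set where
  constructor mkℝ
  field
    seq    : ℕ → ℚ
    cauchy : Cauchy seq

open ℝ public

infix 4 _≃_ _≤_ _≥_ _<_

-- Data types rather than functions, so that x and y can be inferred.
data _≃_ (x y : ℝ) : Set where
  *≃* : (∀ ε → 0ℚ ℚ.< ε → Eventually (λ n → ℚ.∣ seq x n ℚ.- seq y n ∣ ℚ.< ε)) → x ≃ y

data _≤_ (x y : ℝ) : Set where
  *≤* : (∀ ε → 0ℚ ℚ.< ε → Eventually (λ n → seq x n ℚ.< seq y n ℚ.+ ε)) → x ≤ y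

data _<_ (x y : ℝ) : Set where
  *<* : ∀ ε → 0ℚ ℚ.< ε → Eventually (λ n → seq x n ℚ.+ ε ℚ.< seq y n) → x < y

_≥_ : ℝ → ℝ → Set
x ≥ y = y ≤ x

<-≤-trans : ∀ {x y z} → x < y → y ≤ z → x < z
<-≤-trans {x} {y} {z} (*<* ε 0<ε (N , f)) (*≤* y≤z) =
  *<* (½ ℚ.* ε) (0<½p 0<ε) (proj₁ both , λ n le → step (seq x n) (proj₂ both n le))
  where
  both = (N , f) ∩ᵉ y≤z (½ ℚ.* ε) (0<½p 0<ε)
  step : ∀ a {b c} → (a ℚ.+ ε ℚ.< b) × (b ℚ.< c ℚ.+ ½ ℚ.* ε) → a ℚ.+ ½ ℚ.* ε ℚ.< c
  step a {b} {c} (h , h′) = subst₂ ℚ._<_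
    (trans (cong (λ e → a ℚ.+ e ℚ.- ½ ℚ.* ε) (sym (½p+½p ε)))
      (solve 2 (λ a e → a :+ (e :+ e) :- e := a :+ e) refl a (½ ℚ.* ε)))
    (solve 2 (λ c e → c :+ e :- e := c) refl c (½ ℚ.* ε))
    (ℚₚ.+-monoˡ-< (ℚ.- (½ ℚ.* ε)) (ℚₚ.<-trans h h′))
    where open +-*-Solver

abstract
  cauchy-const : ∀ q → Cauchy (λ _ → q)
  cauchy-const q ε 0<ε = 0 , λ _ _ _ _ →
    subst (λ d → ℚ.∣ d ∣ ℚ.< ε) (sym (ℚₚ.+-inverseʳ q)) 0<ε

fromℚ : ℚ → ℝ
fromℚ q = mkℝ (λ _ → q) (cauchy-const q)

fromℕ : ℕ → ℝ
fromℕ n = fromℚ (+ n ℚ./ 1)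

0ℝ 1ℝ : ℝ
0ℝ = fromℕ 0
1ℝ = fromℕ 1

infixl 6 _+_ _-_
infixl 7 _*_
infix  8 -_

abstract
  cauchy-+ : ∀ x y → Cauchy (λ n → seq x n ℚ.+ seq y n)
  cauchy-+ x y ε 0<ε =
    let (N , f) = cauchy x (½ ℚ.* ε) (0<½p 0<ε)
        (K , g) = cauchy y (½ ℚ.* ε) (0<½p 0<ε)
    in N ℕ.⊔ K , λ m n p q →
      step (seq x m) (seq x n) (seq y m) (seq y n)
           (f m n (ℕₚ.m⊔n≤o⇒m≤o N K p) (ℕₚ.m⊔n≤o⇒m≤o N K q))
           (g m n (ℕₚ.m⊔n≤o⇒n≤o N K p) (ℕₚ.m⊔n≤o⇒n≤o N K q))
    where
    step : ∀ a a′ b b′ {ε} →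
           ℚ.∣ a ℚ.- a′ ∣ ℚ.< ½ ℚ.* ε → ℚ.∣ b ℚ.- b′ ∣ ℚ.< ½ ℚ.* ε →
           ℚ.∣ (a ℚ.+ b) ℚ.- (a′ ℚ.+ b′) ∣ ℚ.< ε
    step a a′ b b′ {ε} h h′ = subst₂ ℚ._<_
      (cong ℚ.∣_∣ (solve 4 (λ a a′ b b′ → (a :- a′) :+ (b :- b′) := (a :+ b) :- (a′ :+ b′))
        refl a a′ b b′))
      (½p+½p ε)
      (ℚₚ.≤-<-trans (ℚₚ.∣p+q∣≤∣p∣+∣q∣ (a ℚ.- a′) (b ℚ.- b′)) (ℚₚ.+-mono-< h h′))
      where open +-*-Solver

_+_ : ℝ → ℝ → ℝ
x + y = mkℝ (λ n → seq x n ℚ.+ seq y n) (cauchy-+ x y)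

abstract
  cauchy-neg : ∀ x → Cauchy (λ n → ℚ.- seq x n)
  cauchy-neg x ε 0<ε =
    let (N , f) = cauchy x ε 0<ε
    in N , λ m n p q → subst (ℚ._< ε)
      (trans (∣p-q∣≡∣q-p∣ (seq x m) (seq x n))
        (cong ℚ.∣_∣ (solve 2 (λ a b → b :- a := :- a :- (:- b)) refl (seq x m) (seq x n))))
      (f m n p q)
    where open +-*-Solver

-_ : ℝ → ℝ
- x = mkℝ (λ n → ℚ.- seq x n) (cauchy-neg x)

_-_ : ℝ → ℝ → ℝ
x - y = x + - y

bounded : ∀ x → ∃ λ B → 0ℚ ℚ.< B × Eventually (λ n → ℚ.∣ seq x n ∣ ℚ.≤ B)
bounded x with cauchy x 1ℚ (ℚₚ.positive⁻¹ 1ℚ)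
... | N , f = ℚ.∣ seq x N ∣ ℚ.+ 1ℚ
  , ℚₚ.+-mono-≤-< (ℚₚ.0≤∣p∣ (seq x N)) (ℚₚ.positive⁻¹ 1ℚ)
  , N , λ n N≤n → subst (ℚ._≤ ℚ.∣ seq x N ∣ ℚ.+ 1ℚ)
      (cong ℚ.∣_∣ (solve 2 (λ a b → b :+ (a :- b) := a) refl (seq x n) (seq x N)))
      (ℚₚ.≤-trans (ℚₚ.∣p+q∣≤∣p∣+∣q∣ (seq x N) (seq x n ℚ.- seq x N))
        (ℚₚ.+-monoʳ-≤ ℚ.∣ seq x N ∣ (ℚₚ.<⇒≤ (f n N N≤n ℕₚ.≤-refl))))
  where open +-*-Solver

*-small : ∀ {D p q ε} → 0ℚ ℚ.< D → ℚ.∣ p ∣ ℚ.≤ D →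
          ℚ.∣ q ∣ ℚ.< ε ℚ.* inv D → ℚ.∣ p ℚ.* q ∣ ℚ.< ε
*-small {D} {p} {q} {ε} 0<D h h′ = subst₂ ℚ._<_ (sym (ℚₚ.∣p*q∣≡∣p∣*∣q∣ p q)) cancel
  (ℚₚ.≤-<-trans
    (ℚₚ.*-monoʳ-≤-nonNeg ℚ.∣ q ∣ {{ℚ.nonNegative (ℚₚ.0≤∣p∣ q)}} h)
    (ℚₚ.*-monoʳ-<-pos D {{ℚ.positive 0<D}} h′))
  where
  open +-*-Solver
  regroup : ∀ D e i → D ℚ.* (e ℚ.* i) ≡ (D ℚ.* i) ℚ.* e
  regroup = solve 3 (λ D e i → D :* (e :* i) := (D :* i) :* e) refl
  cancel : D ℚ.* (ε ℚ.* inv D) ≡ ε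
  cancel = trans (regroup D ε (inv D))
    (trans (cong (ℚ._* ε) (*-inv 0<D)) (ℚₚ.*-identityˡ ε))

*-close : ∀ {B C ε} → 0ℚ ℚ.< B → 0ℚ ℚ.< C → ∀ a a′ b b′ →
  ℚ.∣ a ∣ ℚ.≤ B → ℚ.∣ b′ ∣ ℚ.≤ C →
  ℚ.∣ a ℚ.- a′ ∣ ℚ.< ½ ℚ.* ε ℚ.* inv C → ℚ.∣ b ℚ.- b′ ∣ ℚ.< ½ ℚ.* ε ℚ.* inv B →
  ℚ.∣ a ℚ.* b ℚ.- a′ ℚ.* b′ ∣ ℚ.< ε
*-close {ε = ε} 0<B 0<C a a′ b b′ ha hb hx hy = subst₂ ℚ._<_
  (cong ℚ.∣_∣ (solve 4 (λ a a′ b b′ →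
    a :* (b :- b′) :+ b′ :* (a :- a′) := a :* b :- a′ :* b′) refl a a′ b b′))
  (½p+½p ε)
  (ℚₚ.≤-<-trans (ℚₚ.∣p+q∣≤∣p∣+∣q∣ (a ℚ.* (b ℚ.- b′)) (b′ ℚ.* (a ℚ.- a′)))
    (ℚₚ.+-mono-<
      (*-small {p = a} {b ℚ.- b′} {½ ℚ.* ε} 0<B ha hy)
      (*-small {p = b′} {a ℚ.- a′} {½ ℚ.* ε} 0<C hb hx)))
  where open +-*-Solver

cauchy-*-bounded : ∀ x y {B C} → 0ℚ ℚ.< B → 0ℚ ℚ.< C →
  Eventually (λ n → ℚ.∣ seq x n ∣ ℚ.≤ B) → Eventually (λ n → ℚ.∣ seq y n ∣ ℚ.≤ C) →
  Cauchy (λ n → seq x n ℚ.* seq y n)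
cauchy-*-bounded x y {B} {C} 0<B 0<C (N₁ , bx) (N₂ , by) ε 0<ε =
  N₁ ℕ.⊔ (N₂ ℕ.⊔ (N₃ ℕ.⊔ N₄)) , λ m n p q →
    let p′ = ℕₚ.m⊔n≤o⇒n≤o N₁ (N₂ ℕ.⊔ (N₃ ℕ.⊔ N₄)) p
        q′ = ℕₚ.m⊔n≤o⇒n≤o N₁ (N₂ ℕ.⊔ (N₃ ℕ.⊔ N₄)) q
        p″ = ℕₚ.m⊔n≤o⇒n≤o N₂ (N₃ ℕ.⊔ N₄) p′
        q″ = ℕₚ.m⊔n≤o⇒n≤o N₂ (N₃ ℕ.⊔ N₄) q′
    in *-close 0<B 0<C (seq x m) (seq x n) (seq y m) (seq y n)
         (bx m (ℕₚ.m⊔n≤o⇒m≤o N₁ (N₂ ℕ.⊔ (N₃ ℕ.⊔ N₄)) p))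
         (by n (ℕₚ.m⊔n≤o⇒m≤o N₂ (N₃ ℕ.⊔ N₄) q′))
         (proj₂ cx m n (ℕₚ.m⊔n≤o⇒m≤o N₃ N₄ p″) (ℕₚ.m⊔n≤o⇒m≤o N₃ N₄ q″))
         (proj₂ cy m n (ℕₚ.m⊔n≤o⇒n≤o N₃ N₄ p″) (ℕₚ.m⊔n≤o⇒n≤o N₃ N₄ q″))
  where
  cx : ∃ λ N → ∀ m n → N ℕ.≤ m → N ℕ.≤ n →
       ℚ.∣ seq x m ℚ.- seq x n ∣ ℚ.< ½ ℚ.* ε ℚ.* inv C
  cx = cauchy x (½ ℚ.* ε ℚ.* inv C) (0<p*q (0<½p 0<ε) (0<inv 0<C))
  cy : ∃ λ N → ∀ m n → N ℕ.≤ m → N ℕ.≤ n →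
       ℚ.∣ seq y m ℚ.- seq y n ∣ ℚ.< ½ ℚ.* ε ℚ.* inv B
  cy = cauchy y (½ ℚ.* ε ℚ.* inv B) (0<p*q (0<½p 0<ε) (0<inv 0<B))
  N₃ = proj₁ cx
  N₄ = proj₁ cy

abstract
  cauchy-* : ∀ x y → Cauchy (λ n → seq x n ℚ.* seq y n)
  cauchy-* x y =
    let (_ , 0<B , bx) = bounded x
        (_ , 0<C , by) = bounded y
    in cauchy-*-bounded x y 0<B 0<C bx by

_*_ : ℝ → ℝ → ℝ
x * y = mkℝ (λ n → seq x n ℚ.* seq y n) (cauchy-* x y)

infix 9 _²

_² : ℝ → ℝ
x ² = x * x

inv-close : ∀ {δ ε} → 0ℚ ℚ.< δ → ∀ a b → 0ℚ ℚ.+ δ ℚ.< a → 0ℚ ℚ.+ δ ℚ.< b →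
       ℚ.∣ a ℚ.- b ∣ ℚ.< ε ℚ.* (δ ℚ.* δ) → ℚ.∣ inv a ℚ.- inv b ∣ ℚ.< ε
inv-close {δ} {ε} 0<δ a b ha hb h = subst₂ ℚ._<_ (sym lhs) rhs
  (ℚₚ.≤-<-trans
    (ℚₚ.*-monoˡ-≤-nonNeg ℚ.∣ a ℚ.- b ∣ {{ℚ.nonNegative (ℚₚ.0≤∣p∣ (a ℚ.- b))}}
      (*-mono-≤ (ℚₚ.<⇒≤ 0<ib) (ℚₚ.<⇒≤ 0<D) (inv-anti-≤ 0<δ (ℚₚ.<⇒≤ δ<a))
        (inv-anti-≤ 0<δ (ℚₚ.<⇒≤ δ<b))))
    (ℚₚ.*-monoˡ-<-pos (D ℚ.* D) {{ℚ.positive (0<p*q 0<D 0<D)}} h))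
  where
  open +-*-Solver
  D = inv δ
  0<D = 0<inv 0<δ
  δ<a = subst (ℚ._< a) (ℚₚ.+-identityˡ δ) ha
  δ<b = subst (ℚ._< b) (ℚₚ.+-identityˡ δ) hb
  0<a = ℚₚ.<-trans 0<δ δ<a
  0<b = ℚₚ.<-trans 0<δ δ<b
  ia = inv a
  ib = inv b
  0<ia = 0<inv 0<a
  0<ib = 0<inv 0<b

  diff : ia ℚ.- ib ≡ (b ℚ.- a) ℚ.* (ia ℚ.* ib)
  diff = sym (trans
    (solve 4 (λ a b i j → (b :- a) :* (i :* j) := (b :* j) :* i :- (a :* i) :* j)
      refl a b ia ib)
    (cong₂ ℚ._-_
      (trans (cong (ℚ._* ia) (*-inv 0<b)) (ℚₚ.*-identityˡ ia))
      (trans (cong (ℚ._* ib) (*-inv 0<a)) (ℚₚ.*-identityˡ ib))))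

  lhs : ℚ.∣ ia ℚ.- ib ∣ ≡ ℚ.∣ a ℚ.- b ∣ ℚ.* (ia ℚ.* ib)
  lhs = trans (cong ℚ.∣_∣ diff) (trans (ℚₚ.∣p*q∣≡∣p∣*∣q∣ (b ℚ.- a) (ia ℚ.* ib))
    (cong₂ ℚ._*_ (∣p-q∣≡∣q-p∣ b a) (ℚₚ.0≤p⇒∣p∣≡p (ℚₚ.<⇒≤ (0<p*q 0<ia 0<ib)))))

  rhs : ε ℚ.* (δ ℚ.* δ) ℚ.* (D ℚ.* D) ≡ ε
  rhs = trans
    (solve 3 (λ e d i → e :* (d :* d) :* (i :* i) := e :* ((d :* i) :* (d :* i))) refl ε δ D)
    (trans (cong (λ t → ε ℚ.* (t ℚ.* t)) (*-inv 0<δ)) (ℚₚ.*-identityʳ ε))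

cauchy-recip-bounded : ∀ y {δ} → 0ℚ ℚ.< δ → Eventually (λ n → 0ℚ ℚ.+ δ ℚ.< seq y n) →
  Cauchy (λ n → inv (seq y n))
cauchy-recip-bounded y {δ} 0<δ (N , f) ε 0<ε =
  let (K , g) = cauchy y (ε ℚ.* (δ ℚ.* δ)) (0<p*q 0<ε (0<p*q 0<δ 0<δ))
  in N ℕ.⊔ K , λ m n p q → inv-close 0<δ (seq y m) (seq y n)
    (f m (ℕₚ.m⊔n≤o⇒m≤o N K p)) (f n (ℕₚ.m⊔n≤o⇒m≤o N K q))
    (g m n (ℕₚ.m⊔n≤o⇒n≤o N K p) (ℕₚ.m⊔n≤o⇒n≤o N K q))

abstract
  cauchy-recip : ∀ y → 0ℝ < y → Cauchy (λ n → inv (seq y n))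
  cauchy-recip y (*<* δ 0<δ ev) = cauchy-recip-bounded y 0<δ ev

recip : (y : ℝ) → 0ℝ < y → ℝ
recip y 0<y = mkℝ (λ n → inv (seq y n)) (cauchy-recip y 0<y)

infixl 7 _/_[_]

_/_[_] : ℝ → (y : ℝ) → 0ℝ < y → ℝ
x / y [ 0<y ] = x * recip y 0<y

------------------------------------------------------------------------
-- Square root

-- The largest j ≤ b with (j h)² ≤ q, or 0 if there is none.
search : ℚ → ℚ → ℕ → ℕ
search h q zero    = zero
search h q (suc b) =
  if does ((suc b · h) ℚ.* (suc b · h) ℚₚ.≤? q) then suc b else search h q b

-- The square root of max (q , 0), rounded down to a multiple of
-- 1 / (n + 1).  The search bound is large enough because q ≤ |↥ q|.
√ℚ : ℕ → ℚ → ℚ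
√ℚ n q = search h q (suc n ℕ.* suc ℤ.∣ ℚ.↥ q ∣) · h
  where h = + 1 ℚ./ suc n

0≤n/1 : ∀ n → 0ℚ ℚ.≤ (+ n ℚ./ 1)
0≤n/1 n = ℚₚ.nonNegative⁻¹ _ {{ℚₚ.normalize-nonNeg n 1}}

0<1/N : ∀ n → 0ℚ ℚ.< (+ 1 ℚ./ suc n)
0<1/N n = ℚₚ.positive⁻¹ _ {{ℚₚ.normalize-pos 1 (suc n)}}

0≤· : ∀ {h} j → 0ℚ ℚ.≤ h → 0ℚ ℚ.≤ j · h
0≤· zero    0≤h = ℚₚ.≤-refl
0≤· (suc j) 0≤h = ℚₚ.+-mono-≤ 0≤h (0≤· j 0≤h)

1/N≤ε : ∀ ε → 0ℚ ℚ.< ε → Eventually (λ n → (+ 1 ℚ./ suc n) ℚ.≤ ε)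
1/N≤ε ε@(ℚ.mkℚ (+ 0) d c) 0<ε with ℚ.positive 0<ε
... | ()
1/N≤ε ε@(ℚ.mkℚ (ℤ.-[1+ _ ]) d c) 0<ε with ℚ.positive 0<ε
... | ()
1/N≤ε ε@(ℚ.mkℚ (+ suc k) d c) 0<ε = d , λ n d≤n →
  ℚₚ.toℚᵘ-cancel-≤ (ℚᵘₚ.≤-respˡ-≃ (ℚᵘₚ.≃-sym (ℚₚ.toℚᵘ-fromℚᵘ (ℚᵘ.mkℚᵘ (+ 1) n)))
    (ℚᵘ.*≤* (ℤ.+≤+ (ℕₚ.*-mono-≤ {1} {suc k} (s≤s ℕ.z≤n) (s≤s d≤n)))))

suc/1 : ∀ j → (+ suc j ℚ./ 1) ≡ (+ j ℚ./ 1) ℚ.+ 1ℚ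
suc/1 j = ℚₚ.toℚᵘ-injective (begin
  ℚ.toℚᵘ (+ suc j ℚ./ 1)            ≈⟨ ℚₚ.toℚᵘ-fromℚᵘ (ℚᵘ.mkℚᵘ (+ suc j) 0) ⟩
  ℚᵘ.mkℚᵘ (+ suc j) 0               ≈⟨ ℚᵘ.*≡* (cong (ℤ._* + 1) (sym j*1+1)) ⟩
  ℚᵘ.mkℚᵘ (+ j) 0 ℚᵘ.+ ℚᵘ.1ℚᵘ
    ≈⟨ ℚᵘₚ.+-congˡ ℚᵘ.1ℚᵘ (ℚᵘₚ.≃-sym (ℚₚ.toℚᵘ-fromℚᵘ (ℚᵘ.mkℚᵘ (+ j) 0))) ⟩
  ℚ.toℚᵘ (+ j ℚ./ 1) ℚᵘ.+ ℚᵘ.1ℚᵘ    ≈⟨ ℚᵘₚ.≃-sym (ℚₚ.toℚᵘ-homo-+ (+ j ℚ./ 1) 1ℚ) ⟩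
  ℚ.toℚᵘ ((+ j ℚ./ 1) ℚ.+ 1ℚ)       ∎)
  where
  open ℚᵘₚ.≃-Reasoning
  j*1+1 : + j ℤ.* + 1 ℤ.+ + 1 ≡ + suc j
  j*1+1 = trans (cong (ℤ._+ + 1) (ℤₚ.*-identityʳ (+ j))) (cong +_ (ℕₚ.+-comm j 1))

*/1 : ∀ j k → (+ (j ℕ.* k) ℚ./ 1) ≡ (+ j ℚ./ 1) ℚ.* (+ k ℚ./ 1)
*/1 zero    k = sym (ℚₚ.*-zeroˡ (+ k ℚ./ 1))
*/1 (suc j) k = trans (+/1 k (j ℕ.* k)) (trans (cong ((+ k ℚ./ 1) ℚ.+_) (*/1 j k))
  (trans (lemma (+ k ℚ./ 1) (+ j ℚ./ 1))
    (cong (ℚ._* (+ k ℚ./ 1)) (sym (suc/1 j)))))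
  where
  open +-*-Solver
  lemma : ∀ k j → k ℚ.+ j ℚ.* k ≡ (j ℚ.+ 1ℚ) ℚ.* k
  lemma = solve 2 (λ k j → k :+ j :* k := (j :+ con 1ℚ) :* k) refl
  lemma′ : ∀ j k → j ℚ.+ k ℚ.+ 1ℚ ≡ j ℚ.+ 1ℚ ℚ.+ k
  lemma′ = solve 2 (λ j k → j :+ k :+ con 1ℚ := j :+ con 1ℚ :+ k) refl
  +/1 : ∀ j k → (+ (j ℕ.+ k) ℚ./ 1) ≡ (+ j ℚ./ 1) ℚ.+ (+ k ℚ./ 1)
  +/1 zero    k = sym (ℚₚ.+-identityˡ (+ k ℚ./ 1))
  +/1 (suc j) k = trans (suc/1 (j ℕ.+ k)) (trans (cong (ℚ._+ 1ℚ) (+/1 j k))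
    (trans (lemma′ (+ j ℚ./ 1) (+ k ℚ./ 1))
      (cong (ℚ._+ (+ k ℚ./ 1)) (sym (suc/1 j)))))

N*1/N : ∀ n → (+ suc n ℚ./ 1) ℚ.* (+ 1 ℚ./ suc n) ≡ 1ℚ
N*1/N n = ℚₚ.toℚᵘ-injective (begin
  ℚ.toℚᵘ ((+ suc n ℚ./ 1) ℚ.* (+ 1 ℚ./ suc n))
    ≈⟨ ℚₚ.toℚᵘ-homo-* (+ suc n ℚ./ 1) (+ 1 ℚ./ suc n) ⟩
  ℚ.toℚᵘ (+ suc n ℚ./ 1) ℚᵘ.* ℚ.toℚᵘ (+ 1 ℚ./ suc n)
    ≈⟨ ℚᵘₚ.*-cong (ℚₚ.toℚᵘ-fromℚᵘ (ℚᵘ.mkℚᵘ (+ suc n) 0))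
                  (ℚₚ.toℚᵘ-fromℚᵘ (ℚᵘ.mkℚᵘ (+ 1) n)) ⟩
  ℚᵘ.mkℚᵘ (+ suc n) 0 ℚᵘ.* ℚᵘ.mkℚᵘ (+ 1) n
    ≈⟨ ℚᵘ.*≡* (trans (ℤₚ.*-identityʳ (+ suc n ℤ.* + 1)) (trans (ℤₚ.*-identityʳ (+ suc n))
         (sym (trans (ℤₚ.*-identityˡ _) (cong (λ k → + suc k) (ℕₚ.+-identityʳ n)))))) ⟩
  ℚᵘ.1ℚᵘ ∎)
  where open ℚᵘₚ.≃-Reasoning

q≤∣↥q∣ : ∀ q → q ℚ.≤ (+ ℤ.∣ ℚ.↥ q ∣ ℚ./ 1)
q≤∣↥q∣ q@(ℚ.mkℚ i d _) = ℚₚ.toℚᵘ-cancel-≤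
  (ℚᵘₚ.≤-respʳ-≃ (ℚᵘₚ.≃-sym (ℚₚ.toℚᵘ-fromℚᵘ (ℚᵘ.mkℚᵘ (+ ℤ.∣ i ∣) 0))) (ℚᵘ.*≤* (le i)))
  where
  le : ∀ i → i ℤ.* + 1 ℤ.≤ + ℤ.∣ i ∣ ℤ.* + suc d
  le (+ n) = subst (+ n ℤ.* + 1 ℤ.≤_) (ℤₚ.pos-* n (suc d))
    (subst (ℤ._≤ + (n ℕ.* suc d)) (ℤₚ.pos-* n 1)
      (ℤ.+≤+ (ℕₚ.*-monoʳ-≤ n (s≤s ℕ.z≤n))))
  le (ℤ.-[1+ n ]) = ℤ.-≤+

·≡* : ∀ j h → j · h ≡ (+ j ℚ./ 1) ℚ.* h
·≡* zero    h = sym (ℚₚ.*-zeroˡ h)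
·≡* (suc j) h = trans (cong (h ℚ.+_) (·≡* j h))
  (trans (lemma (+ j ℚ./ 1) h) (cong (ℚ._* h) (sym (suc/1 j))))
  where
  open +-*-Solver
  lemma : ∀ j h → h ℚ.+ j ℚ.* h ≡ (j ℚ.+ 1ℚ) ℚ.* h
  lemma = solve 2 (λ j h → h :+ j :* h := (j :+ con 1ℚ) :* h) refl

if-elim : ∀ {P : Set} (Q : ℕ → Set) {j k} (d : Dec P) →
          (P → Q j) → (¬ P → Q k) → Q (if does d then j else k)
if-elim Q (yes p) f g = f p
if-elim Q (no ¬p) f g = g ¬p

search-lower : ∀ h q b → (search h q b · h) ℚ.* (search h q b · h) ℚ.≤ q ℚ.⊔ 0ℚ
search-lower h q zero    = subst (ℚ._≤ q ℚ.⊔ 0ℚ) (sym (ℚₚ.*-zeroˡ 0ℚ)) (ℚₚ.p≤q⊔p q 0ℚ)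
search-lower h q (suc b) = if-elim (λ j → (j · h) ℚ.* (j · h) ℚ.≤ q ℚ.⊔ 0ℚ)
  ((suc b · h) ℚ.* (suc b · h) ℚₚ.≤? q)
  (λ le → ℚₚ.≤-trans le (ℚₚ.p≤p⊔q q 0ℚ))
  (λ _ → search-lower h q b)

search-upper : ∀ h q b → q ℚ.< (suc b · h) ℚ.* (suc b · h) →
  q ℚ.< (suc (search h q b) · h) ℚ.* (suc (search h q b) · h)
search-upper h q zero    lt = lt
search-upper h q (suc b) lt = if-elim (λ j → q ℚ.< (suc j · h) ℚ.* (suc j · h))
  ((suc b · h) ℚ.* (suc b · h) ℚₚ.≤? q)
  (λ _ → lt)
  (λ ≰ → search-upper h q b (ℚₚ.≰⇒> ≰))

√ℚ-lower : ∀ n q → √ℚ n q ℚ.* √ℚ n q ℚ.≤ q ℚ.⊔ 0ℚ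
√ℚ-lower n q = search-lower (+ 1 ℚ./ suc n) q (suc n ℕ.* suc ℤ.∣ ℚ.↥ q ∣)

√ℚ-upper : ∀ n q →
  q ℚ.< (√ℚ n q ℚ.+ (+ 1 ℚ./ suc n)) ℚ.* (√ℚ n q ℚ.+ (+ 1 ℚ./ suc n))
√ℚ-upper n q = subst (λ g → q ℚ.< g ℚ.* g) (ℚₚ.+-comm h (√ℚ n q)) (search-upper h q b q<)
  where
  open +-*-Solver
  h = + 1 ℚ./ suc n
  c = ℤ.∣ ℚ.↥ q ∣
  b = suc n ℕ.* suc c
  C = + suc c ℚ./ 1
  0≤C = 0≤n/1 (suc c)

  lemma : ∀ N C i → N ℚ.* C ℚ.* i ≡ (N ℚ.* i) ℚ.* C
  lemma = solve 3 (λ N C i → N :* C :* i := (N :* i) :* C) refl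

  b×h≡C : b · h ≡ C
  b×h≡C = trans (·≡* b h) (trans (cong (ℚ._* h) (*/1 (suc n) (suc c)))
    (trans (lemma (+ suc n ℚ./ 1) C h)
      (trans (cong (ℚ._* C) (N*1/N n)) (ℚₚ.*-identityˡ C))))

  1≤C : 1ℚ ℚ.≤ C
  1≤C = subst₂ ℚ._≤_ (ℚₚ.+-identityˡ 1ℚ) (sym (suc/1 c)) (ℚₚ.+-monoˡ-≤ 1ℚ (0≤n/1 c))

  q<C : q ℚ.< C
  q<C = ℚₚ.≤-<-trans (q≤∣↥q∣ q) (subst₂ ℚ._<_ (ℚₚ.+-identityʳ (+ c ℚ./ 1)) (sym (suc/1 c))
    (ℚₚ.+-monoʳ-< (+ c ℚ./ 1) (ℚₚ.positive⁻¹ 1ℚ)))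

  C≤ : C ℚ.≤ suc b · h
  C≤ = subst (ℚ._≤ suc b · h) (trans (ℚₚ.+-identityˡ (b · h)) b×h≡C)
    (ℚₚ.+-monoˡ-≤ (b · h) (ℚₚ.<⇒≤ (0<1/N n)))

  q< : q ℚ.< (suc b · h) ℚ.* (suc b · h)
  q< = ℚₚ.<-≤-trans q<C (ℚₚ.≤-trans
    (subst (ℚ._≤ C ℚ.* C) (ℚₚ.*-identityˡ C) (*-mono-≤ 0≤C 0≤C 1≤C ℚₚ.≤-refl))
    (*-mono-≤ 0≤C (ℚₚ.≤-trans 0≤C C≤) C≤ C≤))

0≤√ℚ : ∀ n q → 0ℚ ℚ.≤ √ℚ n q
0≤√ℚ n q = 0≤· (search h q (suc n ℕ.* suc ℤ.∣ ℚ.↥ q ∣)) (ℚₚ.<⇒≤ (0<1/N n))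
  where h = + 1 ℚ./ suc n

√-close : ∀ {s t i p q} e → 0ℚ ℚ.≤ s → 0ℚ ℚ.≤ t → 0ℚ ℚ.≤ i →
  s ℚ.* s ℚ.≤ p ℚ.⊔ 0ℚ → q ℚ.< (t ℚ.+ i) ℚ.* (t ℚ.+ i) →
  0ℚ ℚ.< e → i ℚ.≤ e → p ℚ.< q ℚ.+ e ℚ.* e → s ℚ.< t ℚ.+ (e ℚ.+ e)
√-close {s} {t} {i} {p} {q} e 0≤s 0≤t 0≤i lower upper 0<e i≤e p< =
  p²-cancel-< 0≤s (ℚₚ.+-mono-≤ 0≤t (ℚₚ.+-mono-≤ 0≤e 0≤e))
    (ℚₚ.≤-<-trans lower (ℚₚ.<-≤-trans p⊔0< final))
  where
  open +-*-Solver
  u    = t ℚ.+ e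
  0≤e  = ℚₚ.<⇒≤ 0<e
  0≤u  = ℚₚ.+-mono-≤ 0≤t 0≤e
  t+i≤u = ℚₚ.+-monoʳ-≤ t i≤e
  q<u² : q ℚ.< u ℚ.* u
  q<u² = ℚₚ.<-≤-trans upper
    (*-mono-≤ (ℚₚ.+-mono-≤ 0≤t 0≤i) 0≤u t+i≤u t+i≤u)
  0<u² : 0ℚ ℚ.< u ℚ.* u
  0<u² = 0<p*q 0<u 0<u
    where 0<u = ℚₚ.+-mono-≤-< 0≤t 0<e
  p⊔0< : p ℚ.⊔ 0ℚ ℚ.< u ℚ.* u ℚ.+ e ℚ.* e
  p⊔0< with ℚₚ.≤-total p 0ℚ
  ... | inj₁ p≤0 = subst (ℚ._< _) (sym (ℚₚ.p≤q⇒p⊔q≡q p≤0)) (ℚₚ.+-mono-< 0<u² (0<p*q 0<e 0<e))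
  ... | inj₂ 0≤p = subst (ℚ._< _) (sym (ℚₚ.p≥q⇒p⊔q≡p 0≤p))
    (ℚₚ.<-trans p< (ℚₚ.+-monoˡ-< (e ℚ.* e) q<u²))
  final : u ℚ.* u ℚ.+ e ℚ.* e ℚ.≤ (t ℚ.+ (e ℚ.+ e)) ℚ.* (t ℚ.+ (e ℚ.+ e))
  final = subst₂ ℚ._≤_ (ℚₚ.+-identityʳ _)
    (solve 2 (λ t e → (t :+ e) :* (t :+ e) :+ e :* e :+ (e :* (t :+ e) :+ e :* (t :+ e))
      := (t :+ (e :+ e)) :* (t :+ (e :+ e))) refl t e)
    (ℚₚ.+-monoʳ-≤ (u ℚ.* u ℚ.+ e ℚ.* e) (ℚₚ.+-mono-≤ 0≤eu 0≤eu))
    where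
    0≤eu : 0ℚ ℚ.≤ e ℚ.* u
    0≤eu = subst (ℚ._≤ e ℚ.* u) (ℚₚ.*-zeroˡ u) (*-mono-≤ 0≤u 0≤e 0≤e ℚₚ.≤-refl)

√ℚ-close : ∀ m n p q e → 0ℚ ℚ.< e → (+ 1 ℚ./ suc n) ℚ.≤ e →
  p ℚ.< q ℚ.+ e ℚ.* e → √ℚ m p ℚ.< √ℚ n q ℚ.+ (e ℚ.+ e)
√ℚ-close m n p q e = √-close {p = p} {q} e (0≤√ℚ m p) (0≤√ℚ n q) (ℚₚ.<⇒≤ (0<1/N n))
  (√ℚ-lower m p) (√ℚ-upper n q)

abstract
  cauchy-√ : ∀ x → Cauchy (λ n → √ℚ n (seq x n))
  cauchy-√ x ε 0<ε =
    let e       = ½ ℚ.* ε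
        0<e     = 0<½p 0<ε
        (N , f) = cauchy x (e ℚ.* e) (0<p*q 0<e 0<e)
        (K , g) = 1/N≤ε e 0<e
        close   = λ m n p q → subst (λ d → √ℚ m (seq x m) ℚ.< √ℚ n (seq x n) ℚ.+ d) (½p+½p ε)
          (√ℚ-close m n (seq x m) (seq x n) e 0<e (g n (ℕₚ.m⊔n≤o⇒n≤o N K q))
            (∣p-q∣<r⇒p<q+r (f m n (ℕₚ.m⊔n≤o⇒m≤o N K p) (ℕₚ.m⊔n≤o⇒m≤o N K q))))
    in N ℕ.⊔ K , λ m n p q → ∣p-q∣<r (close m n p q) (close n m q p)

-- Total: √ x is the square root of max (x , 0).
√ : ℝ → ℝ
√ x = mkℝ (λ n → √ℚ n (seq x n)) (cauchy-√ x)

------------------------------------------------------------------------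
-- Suprema

IsUpperBound : Pred ℝ 0ℓ → ℝ → Set
IsUpperBound A u = ∀ a → A a → a ≤ u

IsSupremum : Pred ℝ 0ℓ → ℝ → Set
IsSupremum A z = IsUpperBound A z × (∀ u → IsUpperBound A u → z ≤ u)

------------------------------------------------------------------------
-- The k-objective time series search problem

mean : ∀ {k} .{{_ : ℕ.NonZero k}} → Vector ℝ k → ℝ
mean {k} x = fromℚ (+ 1 ℚ./ k) * foldr _+_ 0ℝ x

-- NonTrivial k is k ≥ 2.
record Problem (k : ℕ) .{{_ : ℕ.NonTrivial k}} : Set where
  field
    m M : Vector ℝ k
    0<m : ∀ i → 0ℝ < m i
    m≤M : ∀ i → m i ≤ M i

  r : Vector ℝ k
  r i = M i / m i [ 0<m i ]

  field
    r-decreasing : ∀ i j → i Fin.≤ j → r i ≥ r j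
    r≥1          : ∀ i → r i ≥ 1ℝ

  InBox : Vector ℝ k → Set
  InBox x = ∀ i → m i ≤ x i × x i ≤ M i

  0<x : ∀ {x} → InBox x → ∀ i → 0ℝ < x i
  0<x {x} box i = <-≤-trans (0<m i) (proj₁ (box i))

  x/m : Vector ℝ k → Vector ℝ k
  x/m x i = x i / m i [ 0<m i ]

  M/x : (x : Vector ℝ k) → InBox x → Vector ℝ k
  M/x x box i = M i / x i [ 0<x box i ]

  private instance
    k≢0 : ℕ.NonZero k
    k≢0 = ℕ.nonTrivial⇒nonZero k

  -- The feasible set, over which the mean of the M i / x i is maximised.
  record S (x : Vector ℝ k) : Set where
    field
      box      : InBox x
      balanced : mean (x/m x) ≃ mean (M/x x box)

  objective : (x : Vector ℝ k) → S x → ℝ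
  objective x x∈S = mean (M/x x (S.box x∈S))

  -- For the arithmetic mean component variant.
  IsCompetitiveRatio : Pred ℝ 0ℓ
  IsCompetitiveRatio = IsSupremum (λ v → Σ (Vector ℝ k) λ x → Σ (S x) λ x∈S → v ≃ objective x x∈S)

module Submission where

-- Put y i = x i / m i and w i = M i / x i.  Both lie above 1 and their
-- product is r i, so y i + w i ≤ r i + 1 and ∣ y i - w i ∣ ≤ r i - 1.  On
-- the feasible set the differences y i - w i sum to zero, hence
-- ∣ y 1 - w 1 ∣ ≤ s = (r 2 - 1) + (r 3 - 1), and
-- (y + w)² = (y - w)² + 4 y w gives y 1 + w 1 ≤ √ (4 r 1 + s²).  The
-- objective is the mean of the (y i + w i) / 2, which yields the upper
-- bound.  All the inequalities are equalities at y 2 = r 2, y 3 = r 3 and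
-- w 1 - y 1 = s; the hypothesis on r 1 makes the resulting y 1 at least 1.

open import Algebra.Bundles using (CommutativeRing)
import Algebra.Solver.Ring as RingSolver
import Algebra.Solver.Ring.AlmostCommutativeRing as ACR
open import Data.Fin using (#_; zero; suc)
open import Data.Integer.Base using (+_)
import Data.Maybe.Base as Maybe
open import Data.Nat.Base using (ℕ; nonTrivial)
open import Data.Product using (_,_; proj₁; proj₂)
open import Data.Rational.Base as ℚ using (ℚ; 0ℚ; 1ℚ; ½)
import Data.Rational.Properties as ℚₚ
import Data.Rational.Solver as ℚ-Solver
open import Data.Sum using ([_,_]′)
open import Data.Vec.Functional using (Vector; []; _∷_)
open import Level using (0ℓ)
open import Relation.Binary.PropositionalEquality as ≡ using (_≡_; cong; subst)
import Relation.Binary.Reasoning.Setoid as SetoidReasoning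
open import Relation.Binary.Structures using (IsEquivalence)
open import Relation.Nullary.Decidable using (dec⇒maybe; from-yes)
open import Relation.Unary using (Pred)
open import Defs

private
  module ℚS = ℚ-Solver.+-*-Solver

  variable
    u v x y z : ℝ

mapᵉ : ∀ {P Q : Pred ℕ 0ℓ} → (∀ n → P n → Q n) → Eventually P → Eventually Q
mapᵉ f (N , p) = N , λ n N≤n → f n (p n N≤n)

-- Order

≤-trans : x ≤ y → y ≤ z → x ≤ z
≤-trans {x} {y} {z} (*≤* p) (*≤* q) = *≤* λ ε 0<ε →
  mapᵉ (λ n (h , h′) → ℚₚ.<-trans h (subst (seq y n ℚ.+ ½ ℚ.* ε ℚ.<_)
      (≡.trans (ℚₚ.+-assoc (seq z n) _ _) (cong (seq z n ℚ.+_) (½p+½p ε)))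
      (ℚₚ.+-monoˡ-< (½ ℚ.* ε) h′)))
    (p _ (0<½p 0<ε) ∩ᵉ q _ (0<½p 0<ε))

eventually-≤⇒≤ : Eventually (λ n → seq x n ℚ.≤ seq y n) → x ≤ y
eventually-≤⇒≤ {x} {y} e = *≤* λ ε 0<ε →
  mapᵉ (λ n h → ℚₚ.≤-<-trans h
      (subst (ℚ._< seq y n ℚ.+ ε) (ℚₚ.+-identityʳ (seq y n)) (ℚₚ.+-monoʳ-< (seq y n) 0<ε))) e

≃⇒≤ : x ≃ y → x ≤ y
≃⇒≤ (*≃* p) = *≤* λ ε 0<ε → mapᵉ (λ _ → ∣p-q∣<r⇒p<q+r) (p ε 0<ε)

≤-antisym : x ≤ y → y ≤ x → x ≃ y
≤-antisym (*≤* p) (*≤* q) = *≃* λ ε 0<ε →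
  mapᵉ (λ _ (h , h′) → ∣p-q∣<r h h′) (p ε 0<ε ∩ᵉ q ε 0<ε)

<⇒≤ : x < y → x ≤ y
<⇒≤ {x} (*<* δ 0<δ e) = eventually-≤⇒≤ (mapᵉ (λ n h → ℚₚ.<⇒≤ (ℚₚ.≤-<-trans
  (subst (ℚ._≤ seq x n ℚ.+ δ) (ℚₚ.+-identityʳ (seq x n))
    (ℚₚ.+-monoʳ-≤ (seq x n) (ℚₚ.<⇒≤ 0<δ))) h)) e)

≃-sym : x ≃ y → y ≃ x
≃-sym {x} {y} (*≃* p) = *≃* λ ε 0<ε →
  mapᵉ (λ n → subst (ℚ._< ε) (∣p-q∣≡∣q-p∣ (seq x n) (seq y n))) (p ε 0<ε)

-- Going through `≤` and antisymmetry reuses the splitting of ε already done in `≤-trans`; `+-cong`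
-- takes the same detour.
≃-trans : x ≃ y → y ≃ z → x ≃ z
≃-trans p q =
  ≤-antisym (≤-trans (≃⇒≤ p) (≃⇒≤ q)) (≤-trans (≃⇒≤ (≃-sym q)) (≃⇒≤ (≃-sym p)))

eventually-≡⇒≃ : Eventually (λ n → seq x n ≡ seq y n) → x ≃ y
eventually-≡⇒≃ e = ≤-antisym
  (eventually-≤⇒≤ (mapᵉ (λ _ → ℚₚ.≤-reflexive) e))
  (eventually-≤⇒≤ (mapᵉ (λ _ h → ℚₚ.≤-reflexive (≡.sym h)) e))

pointwise : (∀ n → seq x n ≡ seq y n) → x ≃ y
pointwise e = eventually-≡⇒≃ (0 , λ n _ → e n)

≃-refl : x ≃ x
≃-refl = pointwise λ _ → ≡.refl

≃-isEquivalence : IsEquivalence _≃_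
≃-isEquivalence = record { refl = ≃-refl ; sym = ≃-sym ; trans = ≃-trans }

+-mono-≤ : x ≤ y → u ≤ v → x + u ≤ y + v
+-mono-≤ {x} {y} {u} {v} (*≤* p) (*≤* q) = *≤* λ ε 0<ε →
  mapᵉ (λ n (h , h′) → subst (seq x n ℚ.+ seq u n ℚ.<_)
      (≡.trans
        (solve 3 (λ y v e → (y :+ e) :+ (v :+ e) := y :+ v :+ (e :+ e)) ≡.refl
          (seq y n) (seq v n) (½ ℚ.* ε))
        (cong (seq y n ℚ.+ seq v n ℚ.+_) (½p+½p ε)))
      (ℚₚ.+-mono-< h h′))
    (p _ (0<½p 0<ε) ∩ᵉ q _ (0<½p 0<ε))
  where open ℚS

+-cong : x ≃ y → u ≃ v → x + u ≃ y + v
+-cong p q =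
  ≤-antisym (+-mono-≤ (≃⇒≤ p) (≃⇒≤ q)) (+-mono-≤ (≃⇒≤ (≃-sym p)) (≃⇒≤ (≃-sym q)))

neg-cong : x ≃ y → - x ≃ - y
neg-cong {x} {y} (*≃* p) = *≃* λ ε 0<ε →
  mapᵉ (λ n → subst (ℚ._< ε) (≡.trans (∣p-q∣≡∣q-p∣ (seq x n) (seq y n)) (cong ℚ.∣_∣
      (solve 2 (λ x y → y :- x := :- x :- :- y) ≡.refl (seq x n) (seq y n)))))
    (p ε 0<ε)
  where open ℚS

*-comm : ∀ x y → x * y ≃ y * x
*-comm x y = pointwise λ n → ℚₚ.*-comm (seq x n) (seq y n)

-- Some B eventually bounds the terms of z, so asking for x and y to be within ε / B makes the
-- products ε-close.
*-congʳ : x ≃ y → x * z ≃ y * z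
*-congʳ {x} {y} {z} (*≃* p) =
  let B , 0<B , z≤B = bounded z in *≃* λ ε 0<ε →
  mapᵉ (λ n (h , h′) → subst (λ d → ℚ.∣ d ∣ ℚ.< ε)
      (solve 3 (λ x y z → z :* (x :- y) := x :* z :- y :* z) ≡.refl
        (seq x n) (seq y n) (seq z n))
      (*-small {p = seq z n} 0<B h h′))
    (z≤B ∩ᵉ p _ (0<p*q 0<ε (0<inv 0<B)))
  where open ℚS

*-cong : x ≃ y → u ≃ v → x * u ≃ y * v
*-cong {x} {y} {u} {v} p q =
  ≃-trans (*-congʳ p) (≃-trans (*-comm y u) (≃-trans (*-congʳ q) (*-comm v y)))

*-inv-cancel : ∀ {p q} → 0ℚ ℚ.< q → p ℚ.* inv q ℚ.* q ≡ p
*-inv-cancel {p} {q} 0<q = begin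
  p ℚ.* inv q ℚ.* q    ≡⟨ ℚₚ.*-assoc p (inv q) q ⟩
  p ℚ.* (inv q ℚ.* q)  ≡⟨ cong (p ℚ.*_) (ℚₚ.*-comm (inv q) q) ⟩
  p ℚ.* (q ℚ.* inv q)  ≡⟨ cong (p ℚ.*_) (*-inv 0<q) ⟩
  p ℚ.* 1ℚ             ≡⟨ ℚₚ.*-identityʳ p ⟩
  p                    ∎
  where open ≡.≡-Reasoning

-- The terms a and b may be slightly negative, but a + δ and b + η are eventually positive.
-- Expanding their positive product leaves a b plus the error η (a + δ) + δ b, and each summand of
-- the error is at most ε / 2.
0≤x*y : 0ℝ ≤ x → 0ℝ ≤ y → 0ℝ ≤ x * y
0≤x*y {x} {y} (*≤* 0≤x) (*≤* 0≤y) =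
  let B , 0<B , x≤B = bounded x
      C , 0<C , y≤C = bounded y
  in *≤* λ ε 0<ε →
    let δ   = ½ ℚ.* ε ℚ.* inv C
        0<δ = 0<p*q (0<½p 0<ε) (0<inv 0<C)
        0<D = ℚₚ.+-mono-< 0<B 0<δ
        -- η is chosen after δ, since it multiplies a + δ, which is bounded only by B + δ.
        η   = ½ ℚ.* ε ℚ.* inv (B ℚ.+ δ)
        0<η = 0<p*q (0<½p 0<ε) (0<inv 0<D)
    in mapᵉ (λ n ((a≤B , b≤C) , (0<a+δ , 0<b+η)) →
         step (seq x n) (seq y n) 0<δ 0<η
           (*-inv-cancel 0<D) (*-inv-cancel 0<C)
           a≤B b≤C 0<a+δ 0<b+η)
       ((x≤B ∩ᵉ y≤C) ∩ᵉ (0≤x δ 0<δ ∩ᵉ 0≤y η 0<η))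
  where
  open ℚS
  step : ∀ a b {B C δ η ε} → 0ℚ ℚ.< δ → 0ℚ ℚ.< η →
         η ℚ.* (B ℚ.+ δ) ≡ ½ ℚ.* ε → δ ℚ.* C ≡ ½ ℚ.* ε →
         ℚ.∣ a ∣ ℚ.≤ B → ℚ.∣ b ∣ ℚ.≤ C → 0ℚ ℚ.< a ℚ.+ δ → 0ℚ ℚ.< b ℚ.+ η →
         0ℚ ℚ.< a ℚ.* b ℚ.+ ε
  step a b {B} {C} {δ} {η} {ε} 0<δ 0<η eB eC a≤B b≤C 0<a+δ 0<b+η = begin-strict
    0ℚ
      <⟨ 0<p*q 0<a+δ 0<b+η ⟩
    (a ℚ.+ δ) ℚ.* (b ℚ.+ η)
      ≡⟨ solve 4 (λ a b d e →
           (a :+ d) :* (b :+ e) := a :* b :+ (e :* (a :+ d) :+ d :* b)) ≡.refl a b δ η ⟩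
    a ℚ.* b ℚ.+ (η ℚ.* (a ℚ.+ δ) ℚ.+ δ ℚ.* b)
      ≤⟨ ℚₚ.+-monoʳ-≤ (a ℚ.* b) (ℚₚ.+-mono-≤
           (ℚₚ.*-monoˡ-≤-nonNeg η {{ℚ.nonNegative (ℚₚ.<⇒≤ 0<η)}}
             (ℚₚ.+-monoˡ-≤ δ (ℚₚ.≤-trans (p≤∣p∣ a) a≤B)))
           (ℚₚ.*-monoˡ-≤-nonNeg δ {{ℚ.nonNegative (ℚₚ.<⇒≤ 0<δ)}}
             (ℚₚ.≤-trans (p≤∣p∣ b) b≤C))) ⟩
    a ℚ.* b ℚ.+ (η ℚ.* (B ℚ.+ δ) ℚ.+ δ ℚ.* C)
      ≡⟨ cong (a ℚ.* b ℚ.+_) (≡.trans (≡.cong₂ ℚ._+_ eB eC) (½p+½p ε)) ⟩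
    a ℚ.* b ℚ.+ ε
      ∎
    where open ℚₚ.≤-Reasoning

-- Square root

0≤√x : ∀ x → 0ℝ ≤ √ x
0≤√x x = eventually-≤⇒≤ (0 , λ n _ → 0≤√ℚ n (seq x n))

-- `√ℚ-lower` compares with q ⊔ 0, and terms of a nonnegative real can be negative. They eventually
-- exceed -ε, so both q and 0 lie below q + ε.
√x²≤x : 0ℝ ≤ x → √ x ² ≤ x
√x²≤x {x} (*≤* 0≤x) = *≤* λ ε 0<ε → mapᵉ (λ n 0<x+ε → ℚₚ.≤-<-trans (√ℚ-lower n (seq x n))
    (⊔-lub-< (x<x+ε (seq x n) 0<ε) 0<x+ε)) (0≤x ε 0<ε)
  where
  ⊔-lub-< : ∀ {p q r} → p ℚ.< r → q ℚ.< r → p ℚ.⊔ q ℚ.< r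
  ⊔-lub-< {p} {q} {r} p<r q<r =
    [ (λ e → subst (ℚ._< r) (≡.sym e) p<r) , (λ e → subst (ℚ._< r) (≡.sym e) q<r) ]′
      (ℚₚ.⊔-sel p q)
  x<x+ε : ∀ x {ε} → 0ℚ ℚ.< ε → x ℚ.< x ℚ.+ ε
  x<x+ε x {ε} 0<ε = subst (ℚ._< x ℚ.+ ε) (ℚₚ.+-identityʳ x) (ℚₚ.+-monoʳ-< x 0<ε)

-- The rational root s falls short by less than h = 1 / (n + 1), and (s + h)² exceeds s² by h (2 s +
-- h). Once s ≤ B and h ≤ 1, this is at most h (2 B + 1), hence at most ε for h ≤ ε / (2 B + 1).
x≤√x² : ∀ x → x ≤ √ x ²
x≤√x² x =
  let B , 0<B , s≤B = bounded (√ x)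
      0<D = ℚₚ.+-mono-< (ℚₚ.+-mono-< 0<B 0<B) (ℚₚ.positive⁻¹ 1ℚ)
  in *≤* λ ε 0<ε →
    mapᵉ (λ n (s≤B , h≤1 , h≤δ) → ℚₚ.<-≤-trans (√ℚ-upper n (seq x n))
        (step (0≤√ℚ n (seq x n)) (ℚₚ.<⇒≤ (0<1/N n)) (*-inv-cancel 0<D)
          (ℚₚ.≤-trans (p≤∣p∣ _) s≤B) h≤1 h≤δ))
      (s≤B ∩ᵉ (1/N≤ε 1ℚ (ℚₚ.positive⁻¹ 1ℚ) ∩ᵉ 1/N≤ε _ (0<p*q 0<ε (0<inv 0<D))))
  where
  step : ∀ {s h B δ ε} → 0ℚ ℚ.≤ s → 0ℚ ℚ.≤ h → δ ℚ.* (B ℚ.+ B ℚ.+ 1ℚ) ≡ ε →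
         s ℚ.≤ B → h ℚ.≤ 1ℚ → h ℚ.≤ δ → (s ℚ.+ h) ℚ.* (s ℚ.+ h) ℚ.≤ s ℚ.* s ℚ.+ ε
  step {s} {h} {B} {δ} {ε} 0≤s 0≤h e s≤B h≤1 h≤δ = begin
    (s ℚ.+ h) ℚ.* (s ℚ.+ h)
      ≡⟨ solve 2 (λ s h → (s :+ h) :* (s :+ h) := s :* s :+ h :* (s :+ s :+ h)) ≡.refl s h ⟩
    s ℚ.* s ℚ.+ h ℚ.* (s ℚ.+ s ℚ.+ h)
      ≤⟨ ℚₚ.+-monoʳ-≤ (s ℚ.* s) (*-mono-≤ (ℚₚ.+-mono-≤ (ℚₚ.+-mono-≤ 0≤s 0≤s) 0≤h)
           (ℚₚ.≤-trans 0≤h h≤δ) h≤δ (ℚₚ.+-mono-≤ (ℚₚ.+-mono-≤ s≤B s≤B) h≤1)) ⟩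
    s ℚ.* s ℚ.+ δ ℚ.* (B ℚ.+ B ℚ.+ 1ℚ)
      ≡⟨ cong (s ℚ.* s ℚ.+_) e ⟩
    s ℚ.* s ℚ.+ ε
      ∎
    where
    open ℚₚ.≤-Reasoning
    open ℚS

√x²≃x : 0ℝ ≤ x → √ x ² ≃ x
√x²≃x {x} 0≤x = ≤-antisym (√x²≤x 0≤x) (x≤√x² x)

-- Ring structure

+-*-commutativeRing : CommutativeRing 0ℓ 0ℓ
+-*-commutativeRing = record
  { Carrier = ℝ
  ; _≈_ = _≃_
  ; _+_ = _+_
  ; _*_ = _*_
  ; -_ = -_
  ; 0# = 0ℝ
  ; 1# = 1ℝ
  ; isCommutativeRing = record
    { isRing = record
      { +-isAbelianGroup = record
        { isGroup = record
          { isMonoid = record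
            { isSemigroup = record
              { isMagma = record { isEquivalence = ≃-isEquivalence ; ∙-cong = +-cong }
              ; assoc = λ x y z → pointwise λ n → ℚₚ.+-assoc (seq x n) (seq y n) (seq z n)
              }
            ; identity = (λ x → pointwise λ n → ℚₚ.+-identityˡ (seq x n))
                       , (λ x → pointwise λ n → ℚₚ.+-identityʳ (seq x n))
            }
          ; inverse = (λ x → pointwise λ n → ℚₚ.+-inverseˡ (seq x n))
                    , (λ x → pointwise λ n → ℚₚ.+-inverseʳ (seq x n))
          ; ⁻¹-cong = neg-cong
          }
        ; comm = λ x y → pointwise λ n → ℚₚ.+-comm (seq x n) (seq y n)
        }
      ; *-cong = *-cong
      ; *-assoc = λ x y z → pointwise λ n → ℚₚ.*-assoc (seq x n) (seq y n) (seq z n)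
      ; *-identity = (λ x → pointwise λ n → ℚₚ.*-identityˡ (seq x n))
                   , (λ x → pointwise λ n → ℚₚ.*-identityʳ (seq x n))
      ; distrib = (λ x y z → pointwise λ n → ℚₚ.*-distribˡ-+ (seq x n) (seq y n) (seq z n))
                , (λ x y z → pointwise λ n → ℚₚ.*-distribʳ-+ (seq x n) (seq y n) (seq z n))
      }
    ; *-comm = *-comm
    }
  }

open CommutativeRing +-*-commutativeRing
  using (setoid; *-identityˡ; *-identityʳ; *-assoc; +-congˡ; +-congʳ; *-congˡ)

private
  ℝ-almostCommutativeRing = ACR.fromCommutativeRing +-*-commutativeRing

  fromℚ-homo : ℚₚ.+-*-rawRing ACR.-Raw-AlmostCommutative⟶ ℝ-almostCommutativeRing
  fromℚ-homo = record
    { ⟦_⟧    = fromℚ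
    ; +-homo = λ _ _ → pointwise λ _ → ≡.refl
    ; *-homo = λ _ _ → pointwise λ _ → ≡.refl
    ; -‿homo = λ _ → pointwise λ _ → ≡.refl
    ; 0-homo = ≃-refl
    ; 1-homo = ≃-refl
    }

-- Coefficients are taken in ℚ, where equality is decidable, so the solver also computes with
-- constants such as 1/3 and 1/6.
module ℝ-Solver = RingSolver ℚₚ.+-*-rawRing ℝ-almostCommutativeRing fromℚ-homo
  (λ p q → Maybe.map (λ e → pointwise λ _ → e) (dec⇒maybe (p ℚₚ.≟ q)))

open ℝ-Solver


-- Compatibility of the order with the ring operations

≤-respˡ-≃ : x ≃ y → x ≤ z → y ≤ z
≤-respˡ-≃ p = ≤-trans (≃⇒≤ (≃-sym p))

≤-respʳ-≃ : x ≃ y → z ≤ x → z ≤ y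
≤-respʳ-≃ p q = ≤-trans q (≃⇒≤ p)

≤-refl : x ≤ x
≤-refl = ≃⇒≤ ≃-refl

fromℚ-mono-≤ : ∀ {p q} → p ℚ.≤ q → fromℚ p ≤ fromℚ q
fromℚ-mono-≤ p≤q = eventually-≤⇒≤ (0 , λ _ _ → p≤q)

0≤fromℚ : ∀ q .{{_ : ℚ.NonNegative q}} → 0ℝ ≤ fromℚ q
0≤fromℚ q = fromℚ-mono-≤ (ℚₚ.nonNegative⁻¹ q)

x≤y⇒0≤y-x : x ≤ y → 0ℝ ≤ y - x
x≤y⇒0≤y-x {x} p = ≤-respˡ-≃ (solve 1 (λ x → x :- x := con 0ℚ) ≃-refl x) (+-mono-≤ p ≤-refl)

-- The usual route to polynomial inequalities below: the solver identifies the difference of the two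
-- sides with a product of nonnegative factors.
0≤y-x⇒x≤y : 0ℝ ≤ y - x → x ≤ y
0≤y-x⇒x≤y {y} {x} p = ≤-respˡ-≃ (solve 1 (λ x → con 0ℚ :+ x := x) ≃-refl x)
  (≤-respʳ-≃ (solve 2 (λ x y → y :- x :+ x := y) ≃-refl x y) (+-mono-≤ p ≤-refl))

x≤x+y : 0ℝ ≤ y → x ≤ x + y
x≤x+y {y} {x} 0≤y = ≤-respˡ-≃ (solve 1 (λ x → x :+ con 0ℚ := x) ≃-refl x) (+-mono-≤ ≤-refl 0≤y)

0≤x+y : 0ℝ ≤ x → 0ℝ ≤ y → 0ℝ ≤ x + y
0≤x+y 0≤x 0≤y = ≤-trans 0≤x (x≤x+y 0≤y)

*-monoˡ-≤ : 0ℝ ≤ z → x ≤ y → z * x ≤ z * y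
*-monoˡ-≤ {z} {x} {y} 0≤z x≤y = 0≤y-x⇒x≤y
  (≤-respʳ-≃ (solve 3 (λ x y z → z :* (y :- x) := z :* y :- z :* x) ≃-refl x y z)
    (0≤x*y 0≤z (x≤y⇒0≤y-x x≤y)))

-- Division

*-recip : ∀ y (0<y : 0ℝ < y) → y * recip y 0<y ≃ 1ℝ
*-recip y (*<* δ 0<δ e) = eventually-≡⇒≃
  (mapᵉ (λ n h → *-inv (ℚₚ.<-trans 0<δ (subst (ℚ._< seq y n) (ℚₚ.+-identityˡ δ) h))) e)

0≤recip : ∀ y (0<y : 0ℝ < y) → 0ℝ ≤ recip y 0<y
0≤recip y (*<* δ 0<δ e) = eventually-≤⇒≤
  (mapᵉ (λ n h → ℚₚ.<⇒≤ (0<inv (ℚₚ.<-trans 0<δ (subst (ℚ._< seq y n) (ℚₚ.+-identityˡ δ) h)))) e)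

-- Evaluates a quotient from a product identity, whichever positivity proof the quotient carries.
/-unique : ∀ (0<y : 0ℝ < y) → z * y ≃ x → x / y [ 0<y ] ≃ z
/-unique {y} {z} {x} 0<y e = begin
  x * recip y 0<y        ≈⟨ *-congʳ e ⟨
  z * y * recip y 0<y    ≈⟨ *-assoc z y (recip y 0<y) ⟩
  z * (y * recip y 0<y)  ≈⟨ *-congˡ (*-recip y 0<y) ⟩
  z * 1ℝ                 ≈⟨ *-identityʳ z ⟩
  z                      ∎
  where open SetoidReasoning setoid

/-*-cancel : ∀ (0<y : 0ℝ < y) → x / y [ 0<y ] * y ≃ x
/-*-cancel {y} {x} 0<y = begin
  x * recip y 0<y * y
    ≈⟨ solve 3 (λ x y i → x :* i :* y := x :* (y :* i)) ≃-refl x y (recip y 0<y) ⟩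
  x * (y * recip y 0<y)  ≈⟨ *-congˡ (*-recip y 0<y) ⟩
  x * 1ℝ                 ≈⟨ *-identityʳ x ⟩
  x                      ∎
  where open SetoidReasoning setoid

y≤x⇒1≤x/y : ∀ (0<y : 0ℝ < y) → y ≤ x → 1ℝ ≤ x / y [ 0<y ]
y≤x⇒1≤x/y {y} {x} 0<y y≤x = 0≤y-x⇒x≤y (≤-respʳ-≃
  (≃-trans
    (solve 3 (λ x y i → (x :- y) :* i := x :* i :- y :* i) ≃-refl x y (recip y 0<y))
    (+-congˡ (neg-cong (*-recip y 0<y))))
  (0≤x*y (x≤y⇒0≤y-x y≤x) (0≤recip y 0<y)))

-- With z, y, x taken as m i, x i, M i, this is the relation between `x/m`, `M/x` and `r`.
/-*-/ : ∀ (0<y : 0ℝ < y) (0<z : 0ℝ < z) → (y / z [ 0<z ]) * (x / y [ 0<y ]) ≃ x / z [ 0<z ]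
/-*-/ {y} {z} {x} 0<y 0<z = ≃-sym (/-unique 0<z (begin
  (y / z [ 0<z ]) * (x / y [ 0<y ]) * z
    ≈⟨ solve 3 (λ a b z → a :* b :* z := b :* (a :* z)) ≃-refl (y / z [ 0<z ]) (x / y [ 0<y ]) z ⟩
  (x / y [ 0<y ]) * ((y / z [ 0<z ]) * z)  ≈⟨ *-congˡ (/-*-cancel 0<z) ⟩
  (x / y [ 0<y ]) * y                      ≈⟨ /-*-cancel 0<y ⟩
  x                                        ∎))
  where open SetoidReasoning setoid

*-cancelˡ-0≤ : 0ℝ < x → 0ℝ ≤ x * y → 0ℝ ≤ y
*-cancelˡ-0≤ {x} {y} 0<x 0≤xy = ≤-respʳ-≃ (/-unique 0<x (*-comm y x)) (0≤x*y 0≤xy (0≤recip x 0<x))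

-- y² - x² = (x + y) (y - x), and strict positivity of x makes x + y invertible, so the first factor
-- can be divided out.
²-cancel-≤ : 0ℝ < x → 0ℝ ≤ y → x ² ≤ y ² → x ≤ y
²-cancel-≤ {x} {y} 0<x 0≤y x²≤y² = 0≤y-x⇒x≤y (*-cancelˡ-0≤ (<-≤-trans 0<x (x≤x+y 0≤y))
  (≤-respʳ-≃ (solve 2 (λ x y → y :* y :- x :* x := (x :+ y) :* (y :- x)) ≃-refl x y)
    (x≤y⇒0≤y-x x²≤y²)))

-- The competitive ratio

private
  variable
    ρ y⃗ w⃗ : Vector ℝ 3

-- With s = `excess ρ`, `discriminant ρ` is the discriminant of t² + s t - ρ (# 0), the quadratic
-- satisfied by the extremal y 1.
excess discriminant ratio : Vector ℝ 3 → ℝ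
excess ρ = (ρ (# 1) - 1ℝ) + (ρ (# 2) - 1ℝ)
discriminant ρ = fromℕ 4 * ρ (# 0) + excess ρ ²
ratio ρ = fromℚ (+ 1 ℚ./ 6) * (√ (discriminant ρ) + (ρ (# 1) + 1ℝ) + (ρ (# 2) + 1ℝ))

mean₃-cong : ∀ (x : Vector ℝ 3) a b c → x zero ≃ a → x (suc zero) ≃ b → x (suc (suc zero)) ≃ c →
             mean x ≃ mean (a ∷ b ∷ c ∷ [])
mean₃-cong x a b c p q r = *-congˡ (+-cong p (+-cong q (+-cong r ≃-refl)))

0≤1 : 0ℝ ≤ 1ℝ
0≤1 = 0≤fromℚ 1ℚ

0<1 : 0ℝ < 1ℝ
-- The gap itself is compared strictly, so it has to be less than 1.
0<1 = *<* ½ (ℚₚ.positive⁻¹ ½) (0 , λ _ _ → from-yes (½ ℚₚ.<? 1ℚ))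

0≤excess : (∀ i → 1ℝ ≤ ρ i) → 0ℝ ≤ excess ρ
0≤excess 1≤ρ = 0≤x+y (x≤y⇒0≤y-x (1≤ρ (# 1))) (x≤y⇒0≤y-x (1≤ρ (# 2)))

0≤discriminant : (∀ i → 1ℝ ≤ ρ i) → 0ℝ ≤ discriminant ρ
0≤discriminant 1≤ρ = 0≤x+y
  (0≤x*y (0≤fromℚ (+ 4 ℚ./ 1)) (≤-trans 0≤1 (1≤ρ (# 0))))
  (0≤x*y (0≤excess 1≤ρ) (0≤excess 1≤ρ))

-- Upper bound for the objective

x+y≤x*y+1 : 1ℝ ≤ x → 1ℝ ≤ y → x + y ≤ x * y + 1ℝ
x+y≤x*y+1 {x} {y} 1≤x 1≤y = 0≤y-x⇒x≤y (≤-respʳ-≃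
  (solve 2 (λ x y → (x :- con 1ℚ) :* (y :- con 1ℚ) := x :* y :+ con 1ℚ :- (x :+ y)) ≃-refl x y)
  (0≤x*y (x≤y⇒0≤y-x 1≤x) (x≤y⇒0≤y-x 1≤y)))

-- The slack is (x + 1) (y - 1), just as it is (x - 1) (y - 1) for the sum.
x-y≤x*y-1 : 0ℝ ≤ x → 1ℝ ≤ y → x - y ≤ x * y - 1ℝ
x-y≤x*y-1 {x} {y} 0≤x 1≤y = 0≤y-x⇒x≤y (≤-respʳ-≃
  (solve 2 (λ x y → (x :+ con 1ℚ) :* (y :- con 1ℚ) := x :* y :- con 1ℚ :- (x :- y)) ≃-refl x y)
  (0≤x*y (0≤x+y 0≤x 0≤1) (x≤y⇒0≤y-x 1≤y)))

-- Equal means turn the first difference into the sum of the two opposite differences, each at most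
-- ρ i - 1. It is applied a second time with y and w exchanged, which bounds the absolute value.
difference≤excess : (∀ i → 1ℝ ≤ y⃗ i) → (∀ i → 1ℝ ≤ w⃗ i) → (∀ i → w⃗ i * y⃗ i ≃ ρ i) →
                    mean y⃗ ≃ mean w⃗ → y⃗ (# 0) - w⃗ (# 0) ≤ excess ρ
difference≤excess {y⃗} {w⃗} {ρ} 1≤y 1≤w w*y≃ρ balanced = ≤-respˡ-≃ (≃-sym difference)
  (+-mono-≤ (bound (# 1)) (bound (# 2)))
  where
  open SetoidReasoning setoid
  bound : ∀ i → w⃗ i - y⃗ i ≤ ρ i - 1ℝ
  bound i = ≤-respʳ-≃ (+-congʳ (w*y≃ρ i)) (x-y≤x*y-1 (≤-trans 0≤1 (1≤w i)) (1≤y i))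

  y₁ = y⃗ (# 0)
  y₂ = y⃗ (# 1)
  y₃ = y⃗ (# 2)
  w₁ = w⃗ (# 0)
  w₂ = w⃗ (# 1)
  w₃ = w⃗ (# 2)

  difference : y₁ - w₁ ≃ (w₂ - y₂) + (w₃ - y₃)
  difference = begin
    y₁ - w₁
      -- Three times the difference of the means is split off, to be cancelled by balance; each
      -- `con 0ℚ` is the base value of the `foldr` in `mean`.
      ≈⟨ solve 6 (λ y₁ y₂ y₃ w₁ w₂ w₃ → y₁ :- w₁ :=
           con (+ 3 ℚ./ 1) :* (con (+ 1 ℚ./ 3) :* (y₁ :+ (y₂ :+ (y₃ :+ con 0ℚ))) :-
             con (+ 1 ℚ./ 3) :* (w₁ :+ (w₂ :+ (w₃ :+ con 0ℚ)))) :+ ((w₂ :- y₂) :+ (w₃ :- y₃)))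
           ≃-refl y₁ y₂ y₃ w₁ w₂ w₃ ⟩
    fromℕ 3 * (mean y⃗ - mean w⃗) + ((w₂ - y₂) + (w₃ - y₃))
      ≈⟨ +-congʳ (*-congˡ (+-congʳ balanced)) ⟩
    fromℕ 3 * (mean w⃗ - mean w⃗) + ((w₂ - y₂) + (w₃ - y₃))
      ≈⟨ solve 2 (λ m d → con (+ 3 ℚ./ 1) :* (m :- m) :+ d := d) ≃-refl
           (mean w⃗) ((w₂ - y₂) + (w₃ - y₃)) ⟩
    (w₂ - y₂) + (w₃ - y₃) ∎

-- By balance the mean of w is half the sum of both means, that is 1/6 of the sum of all y i + w i,
-- and these three sums are bounded separately.
mean≤ratio : (∀ i → 1ℝ ≤ ρ i) → (∀ i → 1ℝ ≤ y⃗ i) → (∀ i → 1ℝ ≤ w⃗ i) →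
             (∀ i → y⃗ i * w⃗ i ≃ ρ i) → mean y⃗ ≃ mean w⃗ → mean w⃗ ≤ ratio ρ
mean≤ratio {ρ} {y⃗} {w⃗} 1≤ρ 1≤y 1≤w y*w≃ρ balanced = ≤-respˡ-≃ (≃-sym average)
  (*-monoˡ-≤ (0≤fromℚ (+ 1 ℚ./ 6)) (+-mono-≤ (+-mono-≤ y₁+w₁≤√ (bound (# 1))) (bound (# 2))))
  where
  open SetoidReasoning setoid
  y₁ = y⃗ (# 0)
  y₂ = y⃗ (# 1)
  y₃ = y⃗ (# 2)
  w₁ = w⃗ (# 0)
  w₂ = w⃗ (# 1)
  w₃ = w⃗ (# 2)
  s = excess ρ

  bound : ∀ i → y⃗ i + w⃗ i ≤ ρ i + 1ℝ
  bound i = ≤-respʳ-≃ (+-congʳ (y*w≃ρ i)) (x+y≤x*y+1 (1≤y i) (1≤w i))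

  y-w≤s : y₁ - w₁ ≤ s
  y-w≤s = difference≤excess 1≤y 1≤w
    (λ i → ≃-trans (*-comm (w⃗ i) (y⃗ i)) (y*w≃ρ i)) balanced

  w-y≤s : w₁ - y₁ ≤ s
  w-y≤s = difference≤excess 1≤w 1≤y y*w≃ρ (≃-sym balanced)

  [y+w]²≤D : (y₁ + w₁) ² ≤ discriminant ρ
  -- The product of the two one-sided slacks is s² - (y - w)², which equals 4 y w + s² - (y + w)².
  [y+w]²≤D = ≤-respʳ-≃ (+-congʳ (*-congˡ (y*w≃ρ (# 0)))) (0≤y-x⇒x≤y (≤-respʳ-≃
    (solve 3 (λ y w s → (s :- (y :- w)) :* (s :- (w :- y)) :=
      con (+ 4 ℚ./ 1) :* (y :* w) :+ s :* s :- (y :+ w) :* (y :+ w)) ≃-refl y₁ w₁ s)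
    (0≤x*y (x≤y⇒0≤y-x y-w≤s) (x≤y⇒0≤y-x w-y≤s))))

  y₁+w₁≤√ : y₁ + w₁ ≤ √ (discriminant ρ)
  y₁+w₁≤√ = ²-cancel-≤
    (<-≤-trans 0<1 (≤-trans (1≤y (# 0)) (x≤x+y (≤-trans 0≤1 (1≤w (# 0))))))
    (0≤√x (discriminant ρ))
    (≤-respʳ-≃ (≃-sym (√x²≃x (0≤discriminant 1≤ρ))) [y+w]²≤D)

  average : mean w⃗ ≃ fromℚ (+ 1 ℚ./ 6) * (y₁ + w₁ + (y₂ + w₂) + (y₃ + w₃))
  average = begin
    mean w⃗
      ≈⟨ solve 1 (λ m → m := con ½ :* (m :+ m)) ≃-refl (mean w⃗) ⟩
    fromℚ ½ * (mean w⃗ + mean w⃗)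
      ≈⟨ *-congˡ (+-congʳ balanced) ⟨
    fromℚ ½ * (mean y⃗ + mean w⃗)
      ≈⟨ solve 6 (λ y₁ y₂ y₃ w₁ w₂ w₃ →
           con ½ :* (con (+ 1 ℚ./ 3) :* (y₁ :+ (y₂ :+ (y₃ :+ con 0ℚ))) :+
             con (+ 1 ℚ./ 3) :* (w₁ :+ (w₂ :+ (w₃ :+ con 0ℚ)))) :=
           con (+ 1 ℚ./ 6) :* (y₁ :+ w₁ :+ (y₂ :+ w₂) :+ (y₃ :+ w₃)))
           ≃-refl y₁ y₂ y₃ w₁ w₂ w₃ ⟩
    fromℚ (+ 1 ℚ./ 6) * (y₁ + w₁ + (y₂ + w₂) + (y₃ + w₃)) ∎

-- The extremal ratios

x*yz≃yx*z : ∀ x y z → x * (y * z) ≃ y * x * z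
x*yz≃yx*z = solve 3 (λ x y z → x :* (y :* z) := y :* x :* z) ≃-refl

1≤x⇒y≤x*y : 1ℝ ≤ x → 0ℝ ≤ y → y ≤ x * y
1≤x⇒y≤x*y {x} {y} 1≤x 0≤y = ≤-respˡ-≃ (*-identityʳ y)
  (≤-respʳ-≃ (*-comm y x) (*-monoˡ-≤ 0≤y 1≤x))

-- These solve y w = ρ (# 0) and w - y = s: y is the positive root of t² + s t - ρ (# 0), and w is
-- minus the other root.
optimal-y optimal-w : Vector ℝ 3 → ℝ
optimal-y ρ = fromℚ ½ * (√ (discriminant ρ) - excess ρ)
optimal-w ρ = fromℚ ½ * (√ (discriminant ρ) + excess ρ)

optimal-y*optimal-w : (∀ i → 1ℝ ≤ ρ i) → optimal-y ρ * optimal-w ρ ≃ ρ (# 0)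
optimal-y*optimal-w {ρ} 1≤ρ = begin
  optimal-y ρ * optimal-w ρ
    ≈⟨ solve 2 (λ q s → con ½ :* (q :- s) :* (con ½ :* (q :+ s)) :=
         con (+ 1 ℚ./ 4) :* (q :* q :- s :* s)) ≃-refl (√ (discriminant ρ)) (excess ρ) ⟩
  fromℚ (+ 1 ℚ./ 4) * (√ (discriminant ρ) ² - excess ρ ²)
    ≈⟨ *-congˡ (+-congʳ (√x²≃x (0≤discriminant 1≤ρ))) ⟩
  fromℚ (+ 1 ℚ./ 4) * (discriminant ρ - excess ρ ²)
    ≈⟨ solve 2 (λ r s → con (+ 1 ℚ./ 4) :* (con (+ 4 ℚ./ 1) :* r :+ s :- s) := r) ≃-refl
         (ρ (# 0)) (excess ρ ²) ⟩
  ρ (# 0) ∎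
  where open SetoidReasoning setoid

-- The claim amounts to 2 + s ≤ √D for the discriminant D. After squaring, the slack is D - (2 + s)²
-- = 4 (ρ (# 0) - 1 - s), nonnegative exactly by the hypothesis on the excess.
1≤optimal-y : (∀ i → 1ℝ ≤ ρ i) → excess ρ ≤ ρ (# 0) - 1ℝ → 1ℝ ≤ optimal-y ρ
1≤optimal-y {ρ} 1≤ρ s≤r₁-1 = 0≤y-x⇒x≤y (≤-respʳ-≃
  (solve 2 (λ q s → con ½ :* (q :- (con (+ 2 ℚ./ 1) :+ s)) := con ½ :* (q :- s) :- con 1ℚ)
    ≃-refl (√ (discriminant ρ)) s)
  (0≤x*y (0≤fromℚ ½) (x≤y⇒0≤y-x 2+s≤√)))
  where
  s = excess ρ

  [2+s]²≤D : (fromℕ 2 + s) ² ≤ discriminant ρ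
  [2+s]²≤D = 0≤y-x⇒x≤y (≤-respʳ-≃
    (solve 2 (λ r s → con (+ 4 ℚ./ 1) :* (r :- con 1ℚ :- s) :=
      con (+ 4 ℚ./ 1) :* r :+ s :* s :- (con (+ 2 ℚ./ 1) :+ s) :* (con (+ 2 ℚ./ 1) :+ s))
      ≃-refl (ρ (# 0)) s)
    (0≤x*y (0≤fromℚ (+ 4 ℚ./ 1)) (x≤y⇒0≤y-x s≤r₁-1)))

  2+s≤√ : fromℕ 2 + s ≤ √ (discriminant ρ)
  2+s≤√ = ²-cancel-≤
    (<-≤-trans 0<1 (≤-trans (fromℚ-mono-≤ (from-yes (1ℚ ℚₚ.≤? (+ 2 ℚ./ 1))))
      (x≤x+y (0≤excess 1≤ρ))))
    (0≤√x (discriminant ρ))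
    (≤-respʳ-≃ (≃-sym (√x²≃x (0≤discriminant 1≤ρ))) [2+s]²≤D)

1≤optimal-w : (∀ i → 1ℝ ≤ ρ i) → excess ρ ≤ ρ (# 0) - 1ℝ → 1ℝ ≤ optimal-w ρ
1≤optimal-w {ρ} 1≤ρ s≤r₁-1 = ≤-trans (1≤optimal-y {ρ} 1≤ρ s≤r₁-1) (≤-respʳ-≃
  (solve 2 (λ q s → con ½ :* (q :- s) :+ s := con ½ :* (q :+ s)) ≃-refl
    (√ (discriminant ρ)) (excess ρ))
  (x≤x+y (0≤excess 1≤ρ)))

-- w exceeds y by s in the first coordinate, and s is also the amount by which ρ (# 1) + ρ (# 2)
-- exceeds 1 + 1.
mean-optimal-y≃mean-optimal-w : ∀ ρ →
  mean (optimal-y ρ ∷ ρ (# 1) ∷ ρ (# 2) ∷ []) ≃ mean (optimal-w ρ ∷ 1ℝ ∷ 1ℝ ∷ [])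
mean-optimal-y≃mean-optimal-w ρ =
  solve 3 (λ q r₂ r₃ → let s = (r₂ :- con 1ℚ) :+ (r₃ :- con 1ℚ) in
    con (+ 1 ℚ./ 3) :* (con ½ :* (q :- s) :+ (r₂ :+ (r₃ :+ con 0ℚ))) :=
    con (+ 1 ℚ./ 3) :* (con ½ :* (q :+ s) :+ (con 1ℚ :+ (con 1ℚ :+ con 0ℚ))))
    ≃-refl (√ (discriminant ρ)) (ρ (# 1)) (ρ (# 2))

ratio≃mean-optimal-w : ∀ ρ → ratio ρ ≃ mean (optimal-w ρ ∷ 1ℝ ∷ 1ℝ ∷ [])
ratio≃mean-optimal-w ρ =
  solve 3 (λ q r₂ r₃ → let s = (r₂ :- con 1ℚ) :+ (r₃ :- con 1ℚ) in
    con (+ 1 ℚ./ 6) :* (q :+ (r₂ :+ con 1ℚ) :+ (r₃ :+ con 1ℚ)) :=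
    con (+ 1 ℚ./ 3) :* (con ½ :* (q :+ s) :+ (con 1ℚ :+ (con 1ℚ :+ con 0ℚ))))
    ≃-refl (√ (discriminant ρ)) (ρ (# 1)) (ρ (# 2))

-- Transfer between ratios and prices

module _ (P : Problem 3) where
  open Problem P

  M/x-unique : ∀ x (box : InBox x) i → z * x i ≃ M i → M/x x box i ≃ z
  M/x-unique {z} x box i = /-unique {x i} {z} {M i} (0<x box i)

  x/m-unique : ∀ x i → z * m i ≃ x i → x/m x i ≃ z
  x/m-unique {z} x i = /-unique {m i} {z} {x i} (0<m i)

  r*m≃M : ∀ i → r i * m i ≃ M i
  r*m≃M i = /-*-cancel {m i} {M i} (0<m i)

  M/x≃1 : ∀ x (box : InBox x) i → x i ≃ M i → M/x x box i ≃ 1ℝ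
  M/x≃1 x box i e = M/x-unique {1ℝ} x box i (≃-trans (*-identityˡ (x i)) e)

  x/m≃r : ∀ x i → x i ≃ M i → x/m x i ≃ r i
  x/m≃r x i e = *-congʳ {x i} {M i} e

  feasible⇒objective≤ratio : ∀ x (x∈S : S x) → objective x x∈S ≤ ratio r
  feasible⇒objective≤ratio x x∈S = mean≤ratio r≥1
    (λ i → y≤x⇒1≤x/y {m i} {x i} (0<m i) (proj₁ (box i)))
    (λ i → y≤x⇒1≤x/y {x i} {M i} (0<x box i) (proj₂ (box i)))
    (λ i → /-*-/ {x i} {m i} {M i} (0<x box i) (0<m i))
    balanced
    where open S x∈S

  -- y₁ and w₁ are variables, and implicit arguments are spelled out, so that
  -- terms are compared without unfolding the arithmetic of ℚ, which is
  -- prohibitively expensive.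
  module _ (y₁ w₁ : ℝ) (1≤y₁ : 1ℝ ≤ y₁) (1≤w₁ : 1ℝ ≤ w₁) (y₁*w₁≃r₁ : y₁ * w₁ ≃ r zero) where

    -- The second and third prices are maximal, which makes `x/m` equal to `r` and `M/x` equal to 1
    -- there; the first price is the one whose `x/m` is y₁.
    corner : Vector ℝ 3
    corner = y₁ * m zero ∷ M (suc zero) ∷ M (suc (suc zero)) ∷ []

    w₁*x₁≃M₁ : w₁ * corner zero ≃ M zero
    w₁*x₁≃M₁ = begin
      w₁ * corner zero    ≈⟨ *-congˡ {w₁} {corner zero} {y₁ * m zero} ≃-refl ⟩
      w₁ * (y₁ * m zero)  ≈⟨ x*yz≃yx*z w₁ y₁ (m zero) ⟩
      y₁ * w₁ * m zero    ≈⟨ *-congʳ {y₁ * w₁} {r zero} {m zero} y₁*w₁≃r₁ ⟩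
      r zero * m zero     ≈⟨ r*m≃M zero ⟩
      M zero              ∎
      where open SetoidReasoning setoid

    0≤x₁ : 0ℝ ≤ corner zero
    0≤x₁ = 0≤x*y {y₁} {m zero} (≤-trans 0≤1 1≤y₁) (<⇒≤ (0<m zero))

    corner-box : InBox corner
    corner-box zero =
        1≤x⇒y≤x*y {y₁} {m zero} 1≤y₁ (<⇒≤ (0<m zero))
      -- The first price stays below M because multiplying it by w₁ ≥ 1 gives exactly M.
      , ≤-trans (1≤x⇒y≤x*y {w₁} {corner zero} 1≤w₁ 0≤x₁)
          (≃⇒≤ {w₁ * corner zero} {M zero} w₁*x₁≃M₁)
    corner-box (suc zero) = m≤M (suc zero) , ≤-refl {M (suc zero)}
    corner-box (suc (suc zero)) = m≤M (suc (suc zero)) , ≤-refl {M (suc (suc zero))}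

    -- `M/x` depends on the box proof through its positivity arguments. Quantifying over `box`
    -- covers both `corner-box` and the proof inside an arbitrary membership in `S`.
    mean-M/x-corner : ∀ box → mean (M/x corner box) ≃ mean (w₁ ∷ 1ℝ ∷ 1ℝ ∷ [])
    mean-M/x-corner box = mean₃-cong (M/x corner box) w₁ 1ℝ 1ℝ
      (M/x-unique {w₁} corner box zero w₁*x₁≃M₁)
      (M/x≃1 corner box (suc zero) (≃-refl {M (suc zero)}))
      (M/x≃1 corner box (suc (suc zero)) (≃-refl {M (suc (suc zero))}))

    mean-x/m-corner : mean (x/m corner) ≃ mean (y₁ ∷ r (suc zero) ∷ r (suc (suc zero)) ∷ [])
    mean-x/m-corner = mean₃-cong (x/m corner) y₁ (r (suc zero)) (r (suc (suc zero)))
      (x/m-unique {y₁} corner zero (≃-refl {y₁ * m zero}))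
      (x/m≃r corner (suc zero) (≃-refl {M (suc zero)}))
      (x/m≃r corner (suc (suc zero)) (≃-refl {M (suc (suc zero))}))

    corner∈S : mean (y₁ ∷ r (suc zero) ∷ r (suc (suc zero)) ∷ []) ≃ mean (w₁ ∷ 1ℝ ∷ 1ℝ ∷ []) →
               S corner
    corner∈S balanced = record
      { box = corner-box
      ; balanced = ≃-trans mean-x/m-corner (≃-trans balanced (≃-sym (mean-M/x-corner corner-box)))
      }

    objective-corner : ∀ c∈S → objective corner c∈S ≃ mean (w₁ ∷ 1ℝ ∷ 1ℝ ∷ [])
    objective-corner c∈S = mean-M/x-corner (S.box c∈S)

theorem5p1 : (P : Problem 3) → let open Problem P
                                   r₁ = r (# 0)
                                   r₂ = r (# 1)
                                   r₃ = r (# 2) in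
    (r₁ - 1ℝ) ≥ (r₂ - 1ℝ) + (r₃ - 1ℝ) →
    IsCompetitiveRatio (fromℚ (+ 1 ℚ./ 6) *
      (√ (fromℕ 4 * r₁ + ((r₂ - 1ℝ) + (r₃ - 1ℝ)) ²) + (r₂ + 1ℝ) + (r₃ + 1ℝ)))
theorem5p1 P s≤r₁-1 =
    (λ v (x , x∈S , v≃) → ≤-trans {v} {objective x x∈S} {ratio r}
      (≃⇒≤ v≃) (feasible⇒objective≤ratio P x x∈S))
  -- The value is attained at x̂, so every upper bound dominates it.
  , (λ u bound → bound (ratio r) (x̂ , x̂∈S , ≃-trans (ratio≃mean-optimal-w r)
      (≃-sym (objective-corner P y₁ w₁ 1≤y₁ 1≤w₁ y₁*w₁≃r₁ x̂∈S))))
  where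
  open Problem P
  y₁ = optimal-y r
  w₁ = optimal-w r

  1≤y₁ : 1ℝ ≤ y₁
  1≤y₁ = 1≤optimal-y {r} r≥1 s≤r₁-1

  1≤w₁ : 1ℝ ≤ w₁
  1≤w₁ = 1≤optimal-w {r} r≥1 s≤r₁-1

  y₁*w₁≃r₁ : y₁ * w₁ ≃ r zero
  y₁*w₁≃r₁ = optimal-y*optimal-w {r} r≥1

  x̂ : Vector ℝ 3
  x̂ = corner P y₁ w₁ 1≤y₁ 1≤w₁ y₁*w₁≃r₁

  x̂∈S : S x̂
  x̂∈S = corner∈S P y₁ w₁ 1≤y₁ 1≤w₁ y₁*w₁≃r₁ (mean-optimal-y≃mean-optimal-w r)
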